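{- Let $\mathcal{G}_{g_1}(n)$ be the set of all unicyclic graphs on $n$ vertices with odd girth, and let $S_3'=G_3(0,0;0,0;0,n-3)$ (a triangle with $n-3$ pendent edges attached at one vertex). Then $\varphi_i(G)\ge\varphi_i(S_3')$ for every $G\in\mathcal{G}_{g_1}(n)$ and every $i=0,1,\dots,n$.
   Context: A unicyclic graph is a simple connected graph containing exactly one cycle; its girth is the length of that cycle. For a graph $G$ on $n$ vertices let $Q(G)=D(G)+A(G)$ be its signless Laplacian matrix ($D(G)$ degree diagonal matrix, $A(G)$ adjacency matrix), and write $\det(xI-Q(G))=\sum_{i=0}^{n}(-1)^i\varphi_i(G)x^{n-i}$. For $g\ge 3$ and nonnegative integers $s_j,t_j$, $G_g(s_1,t_1;\dots;s_g,t_g)$ denotes the connected unicyclic graph obtained from a cycle $u_1u_2\cdots u_gu_1$ by attaching, at each vertex $u_j$, $s_j$ pendent paths of length $2$ and $t_j$ pendent edges. -}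

module Defs where

open import Data.Bool using (Bool; true; false; if_then_else_)
open import Data.Nat using (ℕ; zero; suc; _≤_; _≡ᵇ_)
open import Data.Nat.Properties using ()
open import Data.Integer as ℤ using (ℤ; +_; -_)
open import Data.Fin using (Fin; zero; suc; toℕ; punchIn)
open import Data.List using (List; []; _∷_; _++_; [_]; zip; length)
open import Data.List.Relation.Unary.All using (All)
open import Data.List.Relation.Unary.Unique.Propositional using (Unique)
open import Data.List.Membership.Propositional using (_∈_)
open import Data.Product using (Σ; _×_; _,_; ∃)
open import Data.Sum using (_⊎_)
open import Function.Bundles using (_⇔_)
open import Relation.Binary.PropositionalEquality using (_≡_)

record SimpleGraph (n : ℕ) : Set where
  field
    adj     : Fin n → Fin n → Bool
    symm    : ∀ u v → adj u v ≡ adj v u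
    irrefl  : ∀ v → adj v v ≡ false
open SimpleGraph public

Adj : ∀ {n} → SimpleGraph n → Fin n → Fin n → Set
Adj G u v = adj G u v ≡ true

sumFin : ∀ {A : Set} (_⊕_ : A → A → A) (e : A) {n} → (Fin n → A) → A
sumFin _⊕_ e {zero}  f = e
sumFin _⊕_ e {suc n} f = f zero ⊕ sumFin _⊕_ e (λ i → f (suc i))

b2ℕ : Bool → ℕ
b2ℕ true  = 1
b2ℕ false = 0

degree : ∀ {n} → SimpleGraph n → Fin n → ℕ
degree G v = sumFin Data.Nat._+_ 0 (λ u → b2ℕ (adj G v u))

_==_ : ∀ {n} → Fin n → Fin n → Bool
i == j = toℕ i ≡ᵇ toℕ j

Q : ∀ {n} → SimpleGraph n → Fin n → Fin n → ℤ
Q G i j = if i == j then + degree G i else + b2ℕ (adj G i j)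

data Reach {n} (G : SimpleGraph n) : Fin n → Fin n → Set where
  here : ∀ {v} → Reach G v v
  step : ∀ {u w v} → Adj G u w → Reach G w v → Reach G u v

Connected : ∀ {n} → SimpleGraph n → Set
Connected G = ∀ u v → Reach G u v

rotate : ∀ {A : Set} → List A → List A
rotate []       = []
rotate (x ∷ xs) = xs ++ [ x ]

cycEdges : ∀ {A : Set} → List A → List (A × A)
cycEdges c = zip c (rotate c)

IsCycle : ∀ {n} → SimpleGraph n → List (Fin n) → Set
IsCycle G c = (3 ≤ length c) × Unique c
              × All (λ { (u , v) → Adj G u v }) (cycEdges c)

CycleEdge : ∀ {n} → List (Fin n) → Fin n → Fin n → Set
CycleEdge c u v = ((u , v) ∈ cycEdges c) ⊎ ((v , u) ∈ cycEdges c)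

SameCycle : ∀ {n} → List (Fin n) → List (Fin n) → Set
SameCycle c c' = ∀ u v → CycleEdge c u v ⇔ CycleEdge c' u v

UnicyclicWith : ∀ {n} → SimpleGraph n → List (Fin n) → Set
UnicyclicWith G c = Connected G × IsCycle G c
                    × (∀ c' → IsCycle G c' → SameCycle c c')

data Odd : ℕ → Set where
  odd1 : Odd 1
  odd+2 : ∀ {k} → Odd k → Odd (suc (suc k))

UnicyclicOddGirth : ∀ {n} → SimpleGraph n → Set
UnicyclicOddGirth G = Σ (List (Fin _)) λ c → UnicyclicWith G c × Odd (length c)

-- Polynomials over ℤ as little-endian coefficient lists

Poly : Set
Poly = List ℤ

_⊕_ : Poly → Poly → Poly
[]       ⊕ q        = q
(a ∷ p)  ⊕ []       = a ∷ p
(a ∷ p)  ⊕ (b ∷ q)  = (a ℤ.+ b) ∷ (p ⊕ q)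

scale : ℤ → Poly → Poly
scale a []      = []
scale a (b ∷ p) = (a ℤ.* b) ∷ scale a p

_⊗_ : Poly → Poly → Poly
[]      ⊗ q = []
(a ∷ p) ⊗ q = scale a q ⊕ (+ 0 ∷ (p ⊗ q))

coeff : Poly → ℕ → ℤ
coeff []      _       = + 0
coeff (a ∷ p) zero    = a
coeff (a ∷ p) (suc k) = coeff p k

sign : ℕ → ℤ
sign zero          = + 1
sign (suc zero)    = - (+ 1)
sign (suc (suc k)) = sign k

det : ∀ {n} → (Fin n → Fin n → Poly) → Poly
det {zero}  M = [ + 1 ]
det {suc n} M =
  sumFin _⊕_ [] (λ j → scale (sign (toℕ j))
                          (M zero j ⊗ det (λ r c → M (suc r) (punchIn j c))))

charPolyQ : ∀ {n} → SimpleGraph n → Poly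
charPolyQ G = det (λ i j → if i == j then (- Q G i j) ∷ (+ 1 ∷ [])
                                      else (- Q G i j) ∷ [])

-- det(xI - Q(G)) = Σ_i (-1)^i φ_i(G) x^(n-i)
φ : ∀ {n} → ℕ → SimpleGraph n → ℤ
φ {n} i G = sign i ℤ.* coeff (charPolyQ G) (n Data.Nat.∸ i)

-- S₃' : triangle on vertices 0,1,2 with the remaining n-3 vertices
-- pendent at vertex 0  (≅ G₃(0,0;0,0;0,n-3))

S3'adj : ℕ → ℕ → Bool
S3'adj 0 0 = false
S3'adj 0 _ = true
S3'adj _ 0 = true
S3'adj 1 2 = true
S3'adj 2 1 = true
S3'adj _ _ = false

S3'adj-sym : ∀ a b → S3'adj a b ≡ S3'adj b a
S3'adj-sym 0 0 = Relation.Binary.PropositionalEquality.refl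
S3'adj-sym 0 (suc b) = Relation.Binary.PropositionalEquality.refl
S3'adj-sym (suc a) 0 = Relation.Binary.PropositionalEquality.refl
S3'adj-sym 1 1 = Relation.Binary.PropositionalEquality.refl
S3'adj-sym 1 2 = Relation.Binary.PropositionalEquality.refl
S3'adj-sym 1 (suc (suc (suc b))) = Relation.Binary.PropositionalEquality.refl
S3'adj-sym 2 1 = Relation.Binary.PropositionalEquality.refl
S3'adj-sym 2 2 = Relation.Binary.PropositionalEquality.refl
S3'adj-sym 2 (suc (suc (suc b))) = Relation.Binary.PropositionalEquality.refl
S3'adj-sym (suc (suc (suc a))) 1 = Relation.Binary.PropositionalEquality.refl
S3'adj-sym (suc (suc (suc a))) 2 = Relation.Binary.PropositionalEquality.refl
S3'adj-sym (suc (suc (suc a))) (suc (suc (suc b))) = Relation.Binary.PropositionalEquality.refl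

S3'adj-irr : ∀ a → S3'adj a a ≡ false
S3'adj-irr 0 = Relation.Binary.PropositionalEquality.refl
S3'adj-irr 1 = Relation.Binary.PropositionalEquality.refl
S3'adj-irr 2 = Relation.Binary.PropositionalEquality.refl
S3'adj-irr (suc (suc (suc a))) = Relation.Binary.PropositionalEquality.refl

S3' : (n : ℕ) → SimpleGraph n
S3' n = record
  { adj    = λ u v → S3'adj (toℕ u) (toℕ v)
  ; symm   = λ u v → S3'adj-sym (toℕ u) (toℕ v)
  ; irrefl = λ v → S3'adj-irr (toℕ v)
  }

{-# OPTIONS --safe #-}
module Submission where

-- Write f(G) = det(xI + Q(G)); up to the substitution x ↦ -x and a sign, φ_i(G) are its coefficients, so it
-- suffices to compare such polynomials coefficientwise.  Let ψ(G,u) be the determinant with the row and column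
-- of u deleted.  If w is a pendent vertex attached to u, then
--     f(G + w) = (1 + x) f(G) + x ψ(G,u),
-- and ψ(G + w,v) ≥ (1 + x) ψ(G,v') for a suitable vertex v' of G, because all determinants
-- det(diag(a) + diag(s) Q(G)) with nonnegative weights a and s are nonnegative.  For the triangle with pendent
-- edges at one vertex both relations are equalities at every step, so by induction along a construction of G
-- from its cycle by adding pendent vertices it remains to compare odd cycles with S_3'.  There everything is
-- explicit: opening the cycle at a vertex reduces it to paths, whose determinants satisfy a positive recursion.

-- The obstacle is that minors of `xI + Q(G)` do not belong to smaller graphs: deleting the row and
-- column of a vertex leaves the degrees of its neighbours as they were. The weights absorb this. A
-- lost neighbour survives as a larger `a`, and a deletion can be expressed by the weights (1 , 0)
-- without touching the vertex list, so the graph keeps its unicyclic structure. Every difference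
-- that has to be nonnegative then becomes one more weighted determinant of the same graph, and a
-- single induction over all weights settles them together. The step for f needs ψ at the vertex of
-- attachment, which can be any vertex; therefore ψ is bounded at all vertices at once. Odd girth
-- enters through a sign: when the cycle is opened at a vertex, the two terms that run once around
-- it carry the sign (-1)^(length - 1). Uniqueness of the cycle enters through its vertex set: an
-- unwanted edge is refuted by a cycle that misses a vertex of `c` or contains a vertex outside `c`.

open import Defs
open import Algebra.Bundles using (CommutativeRing; RawRing)
open import Data.Bool using (Bool; true; false; if_then_else_)
open import Data.Empty using (⊥)
open import Data.Fin as Fin using (Fin; zero; suc; toℕ; punchIn)
import Data.Fin.Properties as Fin
open import Data.Integer as ℤ using (ℤ; +_; 0ℤ; 1ℤ; -1ℤ) renaming (_≤_ to _≤ℤ_)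
import Data.Integer.Properties as ℤ
open import Data.Integer.Solver using (module +-*-Solver)
open import Data.List using (List; []; _∷_; _++_; [_]; length; tabulate; zip; initLast; _∷ʳ′_)
open import Data.List.Membership.Propositional using (_∈_; _∉_)
open import Data.List.Membership.Propositional.Properties using (∈-++⁺ˡ; ∈-++⁺ʳ; ∈-++⁻; ∈-∃++; ∈-tabulate⁺)
open import Data.List.Properties using (length-tabulate; length-++; ++-assoc)
open import Data.List.Relation.Binary.Permutation.Propositional as Perm using (_↭_; prep; swap; ↭-sym; ↭⇒↭ₛ)
open import Data.List.Relation.Binary.Permutation.Propositional.Properties using (∈-resp-↭; ++-comm; ↭-length; shift; ++-identityʳ)
import Data.List.Relation.Binary.Permutation.Setoid.Properties as PermSetoid
open import Data.List.Relation.Binary.Subset.Propositional using (_⊆_)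
open import Data.List.Relation.Unary.All as All using (All; []; _∷_)
open import Data.List.Relation.Unary.All.Properties using (¬Any⇒All¬; All¬⇒¬Any)
open import Data.List.Relation.Unary.AllPairs as AllPairs using ([]; _∷_)
open import Data.List.Relation.Unary.Any using (here; there)
open import Data.List.Relation.Unary.Linked using (Linked; []; [-]; _∷_)
open import Data.List.Relation.Unary.Unique.Propositional using (Unique)
import Data.List.Relation.Unary.Unique.Propositional.Properties as Unique
open import Data.Maybe using (Maybe; just; nothing)
open import Data.Nat as ℕ using (ℕ; zero; suc; _≤_; s≤s; z≤n)
import Data.Nat.Properties as ℕ
open import Data.Product using (_×_; _,_; proj₁; proj₂; ∃-syntax)
open import Data.Sum using (inj₁; inj₂; [_,_]′)
open import Function using (id; _∘_; _$_; const)
open import Function.Bundles using (Equivalence)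
import Level
open import Relation.Binary.Definitions using (DecidableEquality)
open import Relation.Binary.PropositionalEquality as ≡ using (_≡_; _≢_)
open import Relation.Nullary using (yes; no; does; contradiction)
open import Relation.Nullary.Decidable using (dec-true; dec-false)

-- A solver for commutative rings with integer coefficients.

module RingSolver {c ℓ} (R : CommutativeRing c ℓ) where

  open CommutativeRing R hiding (zero)
  open import Algebra.Properties.Semiring.Mult.TCOptimised semiring using (×-homo-+; ×1-homo-*) renaming (_×_ to _·_)
  open import Algebra.Properties.Ring ring
  open import Algebra.Properties.AbelianGroup +-abelianGroup using (⁻¹-∙-comm; ⁻¹-involutive)
  open import Algebra.Properties.CommutativeSemigroup +-commutativeSemigroup using (interchange)
  open import Algebra.Solver.Ring.AlmostCommutativeRing
  open import Relation.Binary.Reasoning.Setoid setoid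

  -- Formal differences m − n; the case split makes (1 , 0) denote 1# itself.
  private
    ⟦_⟧ᶜ : ℕ × ℕ → Carrier
    ⟦ m , zero ⟧ᶜ      = m · 1#
    ⟦ m , n@(suc _) ⟧ᶜ = m · 1# - n · 1#

    ⟦⟧ᶜ-diff : ∀ m n → ⟦ m , n ⟧ᶜ ≈ m · 1# - n · 1#
    ⟦⟧ᶜ-diff m zero    = sym (trans (+-congˡ -0#≈0#) (+-identityʳ _))
    ⟦⟧ᶜ-diff m (suc n) = refl

    -- Cancelling common successors leaves a pair with a zero component. This is a normal form, so
    -- coefficients of equal value, in particular those that cancel to zero, are recognised by
    -- comparing pairs.
    reduce : ℕ → ℕ → ℕ × ℕ
    reduce (suc m) (suc n) = reduce m n
    reduce m       n       = m , n

    differences : RawRing _ _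
    differences = record
      { Carrier = ℕ × ℕ
      ; _≈_     = _≡_
      ; _+_     = λ (a , b) (c , d) → reduce (a ℕ.+ c) (b ℕ.+ d)
      ; _*_     = λ (a , b) (c , d) → reduce (a ℕ.* c ℕ.+ b ℕ.* d) (a ℕ.* d ℕ.+ b ℕ.* c)
      ; -_      = λ (a , b) → b , a
      ; 0#      = 0 , 0
      ; 1#      = 1 , 0
      }

    minus-minus : ∀ x y → - (x - y) ≈ y - x
    minus-minus x y = begin
      - (x - y)      ≈⟨ ⁻¹-∙-comm x (- y) ⟨
      - x - (- y)    ≈⟨ +-congˡ (⁻¹-involutive y) ⟩
      - x + y        ≈⟨ +-comm _ _ ⟩
      y - x          ∎

    sum-diff : ∀ x y z w → (x + y) - (z + w) ≈ (x - z) + (y - w)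
    sum-diff x y z w = begin
      (x + y) - (z + w)      ≈⟨ +-congˡ (⁻¹-∙-comm z w) ⟨
      (x + y) + (- z - w)    ≈⟨ interchange _ _ _ _ ⟩
      (x - z) + (y - w)      ∎

    reduce-diff : ∀ m n → ⟦ reduce m n ⟧ᶜ ≈ m · 1# - n · 1#
    reduce-diff zero    n       = ⟦⟧ᶜ-diff zero n
    reduce-diff (suc m) zero    = ⟦⟧ᶜ-diff (suc m) zero
    reduce-diff (suc m) (suc n) = begin
      ⟦ reduce m n ⟧ᶜ                      ≈⟨ reduce-diff m n ⟩
      m · 1# - n · 1#                      ≈⟨ +-identityˡ _ ⟨
      0# + (m · 1# - n · 1#)               ≈⟨ +-congʳ (-‿inverseʳ 1#) ⟨
      (1# - 1#) + (m · 1# - n · 1#)        ≈⟨ sum-diff _ _ _ _ ⟨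
      (1# + m · 1#) - (1# + n · 1#)        ≈⟨ +-cong (×-homo-+ 1# 1 m) (-‿cong (×-homo-+ 1# 1 n)) ⟨
      suc m · 1# - suc n · 1#              ∎

    prod-diff : ∀ x y z w → (x * z + y * w) - (x * w + y * z) ≈ (x - y) * (z - w)
    prod-diff x y z w = sym $ begin
      (x - y) * (z - w)                      ≈⟨ [y-z]x≈yx-zx (z - w) x y ⟩
      x * (z - w) - y * (z - w)              ≈⟨ +-cong (x[y-z]≈xy-xz x z w) (-‿cong (x[y-z]≈xy-xz y z w)) ⟩
      (x * z - x * w) - (y * z - y * w)      ≈⟨ +-congˡ (minus-minus _ _) ⟩
      (x * z - x * w) + (y * w - y * z)      ≈⟨ sum-diff _ _ _ _ ⟨
      (x * z + y * w) - (x * w + y * z)      ∎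

    morphism : differences -Raw-AlmostCommutative⟶ fromCommutativeRing R
    morphism = record
      { ⟦_⟧    = ⟦_⟧ᶜ
      ; +-homo = λ (a , b) (c , d) → begin
          ⟦ reduce (a ℕ.+ c) (b ℕ.+ d) ⟧ᶜ             ≈⟨ reduce-diff (a ℕ.+ c) (b ℕ.+ d) ⟩
          (a ℕ.+ c) · 1# - (b ℕ.+ d) · 1#             ≈⟨ +-cong (×-homo-+ 1# a c) (-‿cong (×-homo-+ 1# b d)) ⟩
          (a · 1# + c · 1#) - (b · 1# + d · 1#)       ≈⟨ sum-diff _ _ _ _ ⟩
          (a · 1# - b · 1#) + (c · 1# - d · 1#)       ≈⟨ +-cong (⟦⟧ᶜ-diff a b) (⟦⟧ᶜ-diff c d) ⟨
          ⟦ a , b ⟧ᶜ + ⟦ c , d ⟧ᶜ                     ∎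
      ; *-homo = λ (a , b) (c , d) → begin
          ⟦ reduce (a ℕ.* c ℕ.+ b ℕ.* d) (a ℕ.* d ℕ.+ b ℕ.* c) ⟧ᶜ
            ≈⟨ reduce-diff (a ℕ.* c ℕ.+ b ℕ.* d) (a ℕ.* d ℕ.+ b ℕ.* c) ⟩
          (a ℕ.* c ℕ.+ b ℕ.* d) · 1# - (a ℕ.* d ℕ.+ b ℕ.* c) · 1#
            ≈⟨ +-cong (homo₂ a c b d) (-‿cong (homo₂ a d b c)) ⟩
          ((a · 1#) * (c · 1#) + (b · 1#) * (d · 1#)) - ((a · 1#) * (d · 1#) + (b · 1#) * (c · 1#))
            ≈⟨ prod-diff _ _ _ _ ⟩
          (a · 1# - b · 1#) * (c · 1# - d · 1#)
            ≈⟨ *-cong (⟦⟧ᶜ-diff a b) (⟦⟧ᶜ-diff c d) ⟨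
          ⟦ a , b ⟧ᶜ * ⟦ c , d ⟧ᶜ ∎
      ; -‿homo = λ (a , b) → trans (⟦⟧ᶜ-diff b a)
                   (trans (sym (minus-minus _ _)) (-‿cong (sym (⟦⟧ᶜ-diff a b))))
      ; 0-homo = refl
      ; 1-homo = refl
      }
      where
      homo₂ : ∀ a b c d → (a ℕ.* b ℕ.+ c ℕ.* d) · 1# ≈ (a · 1#) * (b · 1#) + (c · 1#) * (d · 1#)
      homo₂ a b c d = trans (×-homo-+ 1# (a ℕ.* b) (c ℕ.* d)) (+-cong (×1-homo-* a b) (×1-homo-* c d))

    _≟ᶜ_ : ∀ p q → Maybe (⟦ p ⟧ᶜ ≈ ⟦ q ⟧ᶜ)
    (a , b) ≟ᶜ (c , d) with a ℕ.≟ c | b ℕ.≟ d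
    ... | yes ≡.refl | yes ≡.refl = just refl
    ... | _          | _          = nothing

  open import Algebra.Solver.Ring _ _ morphism _≟ᶜ_ public
    using (Polynomial; solve; _:=_; _:+_; _:*_; _:-_; :-_; con)

  :1 : ∀ {n} → Polynomial n
  :1 = con (1 , 0)

-- Determinants with rows and columns listed by labels.

module ListDeterminant {c ℓ} (R : CommutativeRing c ℓ) {A : Set} where

  open CommutativeRing R hiding (zero)
  open RingSolver R
  open import Algebra.Properties.Ring ring using (-0#≈0#)
  open import Relation.Binary.Reasoning.Setoid setoid

  -- The cofactor sum: the term at position j is (-1)^j times `F` at that entry and the list without
  -- it. Skipped entries are pushed back onto the second argument of `F`.
  alt : (A → List A → Carrier) → List A → Carrier
  alt F []       = 0#
  alt F (c ∷ cs) = F c cs - alt (λ d rest → F d (c ∷ rest)) cs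

  -- The rows and columns are listed by labels, K being the table of entries;
  -- it is 0# when the two lists have different lengths.
  ldet : (A → A → Carrier) → List A → List A → Carrier
  ldet K []       []      = 1#
  ldet K []       (_ ∷ _) = 0#
  ldet K (r ∷ rs) cs      = alt (λ c rest → K r c * ldet K rs rest) cs

  private variable
    F G : A → List A → Carrier
    K L : A → A → Carrier
    xs ys : List A

  sub-cong : ∀ {x y z w} → x ≈ y → z ≈ w → x - z ≈ y - w
  sub-cong p q = +-cong p (-‿cong q)

  -- `F` is only ever evaluated at an entry and its complement; stating this as `e ∷ es ↭ xs` makes
  -- facts about members of `xs` available under the sum.
  alt-cong : ∀ xs → (∀ {e es} → e ∷ es ↭ xs → F e es ≈ G e es) → alt F xs ≈ alt G xs
  alt-cong []       h = refl
  alt-cong (x ∷ xs) h =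
    sub-cong (h Perm.refl) (alt-cong xs λ p → h (Perm.trans (swap _ x Perm.refl) (prep x p)))

  alt-zero : ∀ xs → (∀ {e es} → e ∷ es ↭ xs → F e es ≈ 0#) → alt F xs ≈ 0#
  alt-zero []       h = refl
  alt-zero (x ∷ xs) h = trans
    (sub-cong (h Perm.refl) (alt-zero xs λ p → h (Perm.trans (swap _ x Perm.refl) (prep x p))))
    (-‿inverseʳ 0#)

  alt-* : ∀ k F xs → alt (λ e es → k * F e es) xs ≈ k * alt F xs
  alt-* k F []       = sym (zeroʳ k)
  alt-* k F (x ∷ xs) = trans (+-congˡ (-‿cong (alt-* k _ xs)))
    (solve 3 (λ k f g → k :* f :- k :* g := k :* (f :- g)) refl k _ _)

  alt-- : ∀ F G xs → alt (λ e es → F e es - G e es) xs ≈ alt F xs - alt G xs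
  alt-- F G []       = sym (-‿inverseʳ 0#)
  alt-- F G (x ∷ xs) = trans (+-congˡ (-‿cong (alt-- _ _ xs)))
    (solve 4 (λ f g p q → f :- g :- (p :- q) := f :- p :- (g :- q)) refl _ _ _ _)

  alt-exchange : ∀ (H : A → List A → A → List A → Carrier) xs ys →
    alt (λ x xs′ → alt (λ y ys′ → H x xs′ y ys′) ys) xs ≈
    alt (λ y ys′ → alt (λ x xs′ → H x xs′ y ys′) xs) ys
  alt-exchange H []       ys = sym (alt-zero ys λ _ → refl)
  alt-exchange H (x ∷ xs) ys = trans
    (+-congˡ (-‿cong (alt-exchange (λ d rest → H d (x ∷ rest)) xs ys)))
    (sym (alt-- _ _ ys))

  -- Two entries can be taken out in either order and leave the same list, but taking the earlier
  -- one first moves the later one by one position; hence opposite signs.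
  alt-antisym : ∀ (H : A → A → List A → Carrier) xs →
    alt (λ c → alt (H c)) xs ≈ - alt (λ c → alt (λ d → H d c)) xs
  alt-antisym H []       = sym -0#≈0#
  alt-antisym H (x ∷ xs) = begin
    alt (H x) xs - alt (λ c rest → H c x rest - alt (λ d r → H c d (x ∷ r)) rest) xs
      ≈⟨ +-congˡ (-‿cong (alt-- _ _ xs)) ⟩
    alt (H x) xs - (alt (λ c → H c x) xs - alt (λ c → alt (λ d r → H c d (x ∷ r))) xs)
      ≈⟨ +-congˡ (-‿cong (+-congˡ (-‿cong (alt-antisym (λ c d r → H c d (x ∷ r)) xs)))) ⟩
    alt (H x) xs - (alt (λ c → H c x) xs - - alt (λ c → alt (λ d r → H d c (x ∷ r))) xs)
      ≈⟨ solve 3 (λ f g h → f :- (g :- :- h) := :- (g :- (f :- h))) refl _ _ _ ⟩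
    - (alt (λ c → H c x) xs - (alt (H x) xs - alt (λ c → alt (λ d r → H d c (x ∷ r))) xs))
      ≈⟨ -‿cong (+-congˡ (-‿cong (alt-- _ _ xs))) ⟨
    - (alt (λ c → H c x) xs - alt (λ c rest → H x c rest - alt (λ d r → H d c (x ∷ r)) rest) xs) ∎

  -- The sign is read off the derivation of the permutation. In `ldet-perm` rows and columns are
  -- moved by the same derivation, so it appears squared and `sgn-square` removes it.
  sgn : xs ↭ ys → Carrier
  sgn Perm.refl        = 1#
  sgn (prep x p)       = sgn p
  sgn (swap x y p)     = - sgn p
  sgn (Perm.trans p q) = sgn p * sgn q

  sgn-square : (p : xs ↭ ys) → sgn p * sgn p ≈ 1#
  sgn-square Perm.refl        = *-identityˡ 1#
  sgn-square (prep x p)       = sgn-square p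
  sgn-square (swap x y p)     =
    trans (solve 1 (λ s → :- s :* :- s := s :* s) refl _) (sgn-square p)
  sgn-square (Perm.trans p q) = trans
    (solve 2 (λ s t → (s :* t) :* (s :* t) := (s :* s) :* (t :* t)) refl _ _)
    (trans (*-cong (sgn-square p) (sgn-square q)) (*-identityˡ 1#))

  alt-perm : (∀ e {xs ys} (p : xs ↭ ys) → F e xs ≈ sgn p * F e ys) →
             (p : xs ↭ ys) → alt F xs ≈ sgn p * alt F ys
  alt-perm h Perm.refl = sym (*-identityˡ _)
  alt-perm {F = F} {xs = x ∷ xs} {ys = _ ∷ ys} h (prep x p) = begin
    F x xs - alt (λ d rest → F d (x ∷ rest)) xs
      ≈⟨ sub-cong (h x p) (alt-perm (λ e q → h e (prep x q)) p) ⟩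
    sgn p * F x ys - sgn p * alt (λ d rest → F d (x ∷ rest)) ys
      ≈⟨ solve 3 (λ k f g → k :* f :- k :* g := k :* (f :- g)) refl _ _ _ ⟩
    sgn p * (F x ys - alt (λ d rest → F d (x ∷ rest)) ys) ∎
  alt-perm {F = F} {xs = _ ∷ _ ∷ xs} {ys = _ ∷ _ ∷ ys} h (swap x y p) = begin
    F x (y ∷ xs) - (F y (x ∷ xs) - alt (λ d rest → F d (x ∷ y ∷ rest)) xs)
      ≈⟨ sub-cong (h x (prep y p)) (sub-cong (h y (prep x p))
           (trans (alt-cong xs λ {e} {es} _ → h e (swap x y (Perm.refl {xs = es})))
           (trans (alt-* (- 1#) _ xs)
             (*-congˡ (alt-perm (λ e q → h e (prep y (prep x q))) p))))) ⟩
    sgn p * F x (y ∷ ys) - (sgn p * F y (x ∷ ys) - - 1# * (sgn p * alt (λ d rest → F d (y ∷ x ∷ rest)) ys))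
      ≈⟨ solve 4 (λ s f g k → s :* f :- (s :* g :- (:- :1) :* (s :* k)) := :- s :* (g :- (f :- k))) refl _ _ _ _ ⟩
    - sgn p * (F y (x ∷ ys) - (F x (y ∷ ys) - alt (λ d rest → F d (y ∷ x ∷ rest)) ys)) ∎
  alt-perm h (Perm.trans p q) =
    trans (alt-perm h p) (trans (*-congˡ (alt-perm h q)) (sym (*-assoc _ _ _)))

  ldet-cong : ∀ rs cs → (∀ {r c} → r ∈ rs → c ∈ cs → K r c ≈ L r c) → ldet K rs cs ≈ ldet L rs cs
  ldet-cong []       []      h = refl
  ldet-cong []       (_ ∷ _) h = refl
  ldet-cong (r ∷ rs) cs      h = alt-cong cs λ p →
    *-cong (h (here ≡.refl) (∈-resp-↭ p (here ≡.refl)))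
           (ldet-cong rs _ λ r∈ c∈ → h (there r∈) (∈-resp-↭ p (there c∈)))

  ldet-cols-perm : ∀ K rs (p : xs ↭ ys) → ldet K rs xs ≈ sgn p * ldet K rs ys
  ldet-cols-perm K []       Perm.refl        = sym (*-identityˡ _)
  ldet-cols-perm K []       (prep x p)       = sym (zeroʳ _)
  ldet-cols-perm K []       (swap x y p)     = sym (zeroʳ _)
  ldet-cols-perm K []       (Perm.trans p q) =
    trans (ldet-cols-perm K [] p) (trans (*-congˡ (ldet-cols-perm K [] q)) (sym (*-assoc _ _ _)))
  ldet-cols-perm K (r ∷ rs) p = alt-perm (λ e q → trans (*-congˡ (ldet-cols-perm K rs q))
    (solve 3 (λ k s d → k :* (s :* d) := s :* (k :* d)) refl _ _ _)) p

  ldet-rows-perm : ∀ K cs (p : xs ↭ ys) → ldet K xs cs ≈ sgn p * ldet K ys cs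
  ldet-rows-perm K cs Perm.refl        = sym (*-identityˡ _)
  ldet-rows-perm K cs (prep x p)       = trans
    (alt-cong cs λ _ → trans (*-congˡ (ldet-rows-perm K _ p))
      (solve 3 (λ k s d → k :* (s :* d) := s :* (k :* d)) refl _ _ _))
    (alt-* (sgn p) _ cs)
  -- Expanding along both leading rows turns their exchange into an exchange of the two chosen
  -- columns, which `alt-antisym` handles.
  ldet-rows-perm {xs = _ ∷ _ ∷ xs} {ys = _ ∷ _ ∷ ys} K cs (swap x y p) = begin
    alt (λ c rest → K x c * alt (λ d r → K y d * ldet K xs r) rest) cs
      ≈⟨ alt-cong cs (λ {_} {es} _ → trans (sym (alt-* _ _ es)) (alt-cong es λ _ →
           trans (*-congˡ (*-congˡ (ldet-rows-perm K _ p)))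
             (solve 4 (λ k l s d → k :* (l :* (s :* d)) := s :* (k :* (l :* d))) refl _ _ _ _))) ⟩
    alt (λ c → alt (λ d r → sgn p * (K x c * (K y d * ldet K ys r)))) cs
      ≈⟨ alt-cong cs (λ {_} {es} _ → alt-* _ _ es) ⟩
    alt (λ c rest → sgn p * alt (λ d r → K x c * (K y d * ldet K ys r)) rest) cs
      ≈⟨ alt-* _ _ cs ⟩
    sgn p * alt (λ c → alt (λ d r → K x c * (K y d * ldet K ys r))) cs
      ≈⟨ *-congˡ (alt-antisym _ cs) ⟩
    sgn p * - alt (λ c → alt (λ d r → K x d * (K y c * ldet K ys r))) cs
      ≈⟨ solve 2 (λ s a → s :* :- a := :- s :* a) refl _ _ ⟩
    - sgn p * alt (λ c → alt (λ d r → K x d * (K y c * ldet K ys r))) cs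
      ≈⟨ *-congˡ (alt-cong cs λ {_} {es} _ → trans (alt-cong es λ _ →
           solve 3 (λ k l d → k :* (l :* d) := l :* (k :* d)) refl _ _ _) (alt-* _ _ es)) ⟩
    - sgn p * alt (λ c rest → K y c * alt (λ d r → K x d * ldet K ys r) rest) cs ∎
  ldet-rows-perm K cs (Perm.trans p q) =
    trans (ldet-rows-perm K cs p) (trans (*-congˡ (ldet-rows-perm K cs q)) (sym (*-assoc _ _ _)))

  ldet-perm : ∀ K (p : xs ↭ ys) → ldet K xs xs ≈ ldet K ys ys
  ldet-perm {xs = xs} {ys = ys} K p = begin
    ldet K xs xs                    ≈⟨ ldet-rows-perm K _ p ⟩
    sgn p * ldet K ys xs            ≈⟨ *-congˡ (ldet-cols-perm K ys p) ⟩
    sgn p * (sgn p * ldet K ys ys)  ≈⟨ *-assoc _ _ _ ⟨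
    (sgn p * sgn p) * ldet K ys ys  ≈⟨ *-congʳ (sgn-square p) ⟩
    1# * ldet K ys ys               ≈⟨ *-identityˡ _ ⟩
    ldet K ys ys                    ∎

  -- By induction each minor of the row expansion is expanded along the column `c`; the double sum,
  -- read in the other order, consists of row expansions of the minors belonging to that column.
  ldet-col-expand : ∀ K rs c cs → ldet K rs (c ∷ cs) ≈ alt (λ r rest → K r c * ldet K rest cs) rs
  ldet-col-expand K []       c cs = refl
  ldet-col-expand K (r ∷ rs) c cs = +-congˡ (-‿cong (begin
    alt (λ d rest → K r d * ldet K rs (c ∷ rest)) cs
      ≈⟨ alt-cong cs (λ _ → trans (*-congˡ (ldet-col-expand K rs c _)) (sym (alt-* _ _ rs))) ⟩
    alt (λ d rest → alt (λ y ys → K r d * (K y c * ldet K ys rest)) rs) cs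
      ≈⟨ alt-exchange _ cs rs ⟩
    alt (λ y ys → alt (λ d rest → K r d * (K y c * ldet K ys rest)) cs) rs
      ≈⟨ alt-cong rs (λ _ → trans (alt-cong cs λ _ →
           solve 3 (λ k l d → k :* (l :* d) := l :* (k :* d)) refl _ _ _) (alt-* _ _ cs)) ⟩
    alt (λ y ys → K y c * ldet K (r ∷ ys) cs) rs ∎))

  alt-head : ∀ (f : A → Carrier) (G : A → List A → Carrier) x xs → (∀ {e} → e ∈ xs → f e ≈ 0#) →
             alt (λ e es → f e * G e es) (x ∷ xs) ≈ f x * G x xs
  alt-head f G x xs h = trans
    (+-congˡ (trans (-‿cong (alt-zero xs λ p → trans (*-congʳ (h (∈-resp-↭ p (here ≡.refl)))) (zeroˡ _))) -0#≈0#))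
    (+-identityʳ _)

  signed : ℕ → Carrier → Carrier
  signed zero    x = x
  signed (suc n) x = - signed n x

  alt-last : ∀ (f : A → Carrier) (G : A → List A → Carrier) xs y → (∀ {e} → e ∈ xs → f e ≈ 0#) →
             alt (λ e es → f e * G e es) (xs ++ [ y ]) ≈ signed (length xs) (f y * G y xs)
  alt-last f G []       y h = trans (+-congˡ -0#≈0#) (+-identityʳ _)
  alt-last f G (x ∷ xs) y h = trans
    (+-cong (trans (*-congʳ (h (here ≡.refl))) (zeroˡ _)) (-‿cong (alt-last f _ xs y (h ∘ there))))
    (+-identityˡ _)

  -- Links the characteristic matrix to `entry`: the entries of `XI - Q` are the negatives of those
  -- of `-XI + Q`.
  ldet-neg : ∀ K rs cs → ldet (λ r c → - K r c) rs cs ≈ signed (length rs) (ldet K rs cs)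
  ldet-neg K []       []      = refl
  ldet-neg K []       (_ ∷ _) = refl
  ldet-neg K (r ∷ rs) cs      = begin
    alt (λ c rest → - K r c * ldet (λ r c → - K r c) rs rest) cs
      ≈⟨ alt-cong cs (λ _ → trans (*-congˡ (ldet-neg K rs _)) (move (length rs))) ⟩
    alt (λ c rest → signed (suc (length rs)) 1# * (K r c * ldet K rs rest)) cs
      ≈⟨ alt-* _ _ cs ⟩
    signed (suc (length rs)) 1# * ldet K (r ∷ rs) cs
      ≈⟨ signed-* (suc (length rs)) ⟨
    signed (suc (length rs)) (ldet K (r ∷ rs) cs) ∎
    where
    signed-* : ∀ n {x} → signed n x ≈ signed n 1# * x
    signed-* zero    = sym (*-identityˡ _)
    signed-* (suc n) = trans (-‿cong (signed-* n)) (solve 2 (λ s x → :- (s :* x) := :- s :* x) refl _ _)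
    move : ∀ n {k d} → - k * signed n d ≈ signed (suc n) 1# * (k * d)
    move n = trans (*-congˡ (signed-* n))
      (solve 3 (λ k s d → :- k :* (s :* d) := :- s :* (k :* d)) refl _ _ _)

-- Determinants of weighted signless Laplacians: leaves and odd cycles.

module WeightedGraph {c ℓ} (R : CommutativeRing c ℓ) {A : Set} (_≟_ : DecidableEquality A)
  (adj : A → A → Bool) (adj-sym : ∀ u v → adj u v ≡ adj v u) (adj-irrefl : ∀ v → adj v v ≡ false) where

  open CommutativeRing R hiding (zero)
  open RingSolver R
  open ListDeterminant R {A}
  open import Relation.Binary.Reasoning.Setoid setoid

  private variable
    u v w y z k l : A
    us vs xs ys q : List A
    a a′ s s′ : A → Carrier

  ι : Bool → Carrier
  ι true  = 1#
  ι false = 0#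

  deg : List A → A → Carrier
  deg []       y = 0#
  deg (z ∷ zs) y = ι (adj y z) + deg zs y

  -- diag(a) + diag(s) · (signless Laplacian of the subgraph induced on vs);
  -- the weights (1 , 0) at a vertex amount to deleting its row and column.
  entry : List A → (a s : A → Carrier) → A → A → Carrier
  entry vs a s y z = if does (y ≟ z) then a y + s y * deg vs y else s y * ι (adj y z)

  D : List A → (a s : A → Carrier) → Carrier
  D vs a s = ldet (entry vs a s) vs vs

  -- Removing `w` from the vertex list lowers the degree of each neighbour `y` and so costs its
  -- diagonal entry `s y`. Adding `s y` to `a y` restores the entry, which makes minors determinants
  -- of the same kind.
  absorb : A → (a s : A → Carrier) → A → Carrier
  absorb w a s y = if adj y w then a y + s y else a y

  infixl 9 _[_≔_]
  _[_≔_] : (A → Carrier) → A → Carrier → A → Carrier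
  (f [ u ≔ r ]) y = if does (y ≟ u) then r else f y

  ≔-here : ∀ f {r} u → (f [ u ≔ r ]) u ≡ r
  ≔-here f u rewrite dec-true (u ≟ u) ≡.refl = ≡.refl

  ≔-there : ∀ f {r} → y ≢ u → (f [ u ≔ r ]) y ≡ f y
  ≔-there {y = y} {u = u} f y≢u rewrite dec-false (y ≟ u) y≢u = ≡.refl

  ∉-≢ : u ∉ vs → v ∈ vs → v ≢ u
  ∉-≢ u∉ v∈ ≡.refl = u∉ v∈

  head∉ : Unique (u ∷ vs) → u ∉ vs
  head∉ (p ∷ _) = All¬⇒¬Any p

  deg-perm : ∀ y → xs ↭ ys → deg xs y ≈ deg ys y
  deg-perm y Perm.refl        = refl
  deg-perm y (prep x p)       = +-congˡ (deg-perm y p)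
  deg-perm y (swap x x′ p)    = trans (+-congˡ (+-congˡ (deg-perm y p)))
    (solve 3 (λ a b c → a :+ (b :+ c) := b :+ (a :+ c)) refl _ _ _)
  deg-perm y (Perm.trans p q) = trans (deg-perm y p) (deg-perm y q)

  entry-diag : ∀ vs a s y → entry vs a s y y ≡ a y + s y * deg vs y
  entry-diag vs a s y rewrite dec-true (y ≟ y) ≡.refl = ≡.refl

  entry-off : ∀ vs a s → y ≢ z → entry vs a s y z ≡ s y * ι (adj y z)
  entry-off {y} {z} vs a s y≢z rewrite dec-false (y ≟ z) y≢z = ≡.refl

  entry-edge : ∀ vs a s → y ≢ z → adj y z ≡ true → entry vs a s y z ≈ s y
  entry-edge vs a s y≢z e rewrite entry-off vs a s y≢z | e = *-identityʳ _

  entry-nonedge : ∀ vs a s → y ≢ z → adj y z ≡ false → entry vs a s y z ≈ 0#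
  entry-nonedge vs a s y≢z e rewrite entry-off vs a s y≢z | e = zeroʳ _

  entry-perm : ∀ a s y z → xs ↭ ys → entry xs a s y z ≈ entry ys a s y z
  entry-perm a s y z p with does (y ≟ z)
  ... | true  = +-congˡ (*-congˡ (deg-perm y p))
  ... | false = refl

  entry-absorb : ∀ w vs a s y z → entry (w ∷ vs) a s y z ≈ entry vs (absorb w a s) s y z
  entry-absorb w vs a s y z with does (y ≟ z)
  ... | false = refl
  ... | true with adj y w
  ...   | true  = solve 3 (λ a s d → a :+ s :* (:1 :+ d) := (a :+ s) :+ s :* d) refl _ _ _
  ...   | false = +-congˡ (*-congˡ (+-identityˡ _))

  entry-cong : ∀ us a a′ s s′ → a y ≈ a′ y → s y ≈ s′ y → entry us a s y z ≈ entry us a′ s′ y z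
  entry-cong {y = y} {z = z} us a a′ s s′ p q with does (y ≟ z)
  ... | true  = +-cong p (*-congʳ q)
  ... | false = *-congʳ q

  absorb-cong : ∀ w a a′ s s′ → a y ≈ a′ y → s y ≈ s′ y → absorb w a s y ≈ absorb w a′ s′ y
  absorb-cong {y = y} w a a′ s s′ p q with adj y w
  ... | true  = +-cong p q
  ... | false = p

  absorb-edge : ∀ a s → adj y w ≡ true → absorb w a s y ≡ a y + s y
  absorb-edge a s e rewrite e = ≡.refl

  absorb-nonedge : ∀ a s → adj y w ≡ false → absorb w a s y ≡ a y
  absorb-nonedge a s e rewrite e = ≡.refl

  D-cong : ∀ vs → (∀ {y} → y ∈ vs → a y ≈ a′ y) → (∀ {y} → y ∈ vs → s y ≈ s′ y) → D vs a s ≈ D vs a′ s′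
  D-cong {a} {a′} {s} {s′} vs p q = ldet-cong vs vs λ y∈ _ → entry-cong vs a a′ s s′ (p y∈) (q y∈)

  D-perm : ∀ a s → xs ↭ ys → D xs a s ≈ D ys a s
  D-perm {xs = xs} a s p = trans (ldet-cong xs xs λ _ _ → entry-perm a s _ _ p) (ldet-perm _ p)

  ldet-absorb : ∀ u vs a s xs ys → ldet (entry (u ∷ vs) a s) xs ys ≈ ldet (entry vs (absorb u a s) s) xs ys
  ldet-absorb u vs a s xs ys = ldet-cong xs ys λ _ _ → entry-absorb u vs a s _ _

  -- The cofactor expansion along the row of `u` in the signless Laplacian itself, that is, the
  -- coefficient of `s u` in the determinant.
  rest : A → List A → (a s : A → Carrier) → Carrier
  rest u vs a s = deg vs u * D vs (absorb u a s) s
    - alt (λ z zs → ι (adj u z) * ldet (entry vs (absorb u a s) s) vs (u ∷ zs)) vs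

  rest-cong : ∀ u vs → (∀ {y} → y ∈ vs → a y ≈ a′ y) → (∀ {y} → y ∈ vs → s y ≈ s′ y) →
              rest u vs a s ≈ rest u vs a′ s′
  rest-cong {a} {a′} {s} {s′} u vs p q = sub-cong
    (*-congˡ (D-cong vs (λ y∈ → absorb-cong u a a′ s s′ (p y∈) (q y∈)) q))
    (alt-cong vs λ _ → *-congˡ (ldet-cong vs _ λ y∈ _ →
      entry-cong vs (absorb u a s) (absorb u a′ s′) s s′ (absorb-cong u a a′ s s′ (p y∈) (q y∈)) (q y∈)))

  -- The row of u is linear in the pair (a u , s u), on which nothing else depends.
  D-row : ∀ a s → u ∉ vs → D (u ∷ vs) a s ≈ a u * D vs (absorb u a s) s + s u * rest u vs a s
  D-row {u} {vs} a s u∉ = begin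
    entry (u ∷ vs) a s u u * ldet (entry (u ∷ vs) a s) vs vs
      - alt (λ z zs → entry (u ∷ vs) a s u z * ldet (entry (u ∷ vs) a s) vs (u ∷ zs)) vs
      ≈⟨ sub-cong
           (*-cong diagonal (ldet-absorb u vs a s vs vs))
           (trans (alt-cong vs λ p → trans (*-cong
               (reflexive (entry-off (u ∷ vs) a s (∉-≢ u∉ (∈-resp-↭ p (here ≡.refl)) ∘ ≡.sym)))
               (ldet-absorb u vs a s vs _))
               (*-assoc _ _ _))
             (alt-* (s u) _ vs)) ⟩
    (a u + s u * deg vs u) * D vs (absorb u a s) s
      - s u * alt (λ z zs → ι (adj u z) * ldet (entry vs (absorb u a s) s) vs (u ∷ zs)) vs
      ≈⟨ solve 5 (λ a s d m t → (a :+ s :* d) :* m :- s :* t := a :* m :+ s :* (d :* m :- t)) refl _ _ _ _ _ ⟩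
    a u * D vs (absorb u a s) s + s u * rest u vs a s ∎
    where
    diagonal : entry (u ∷ vs) a s u u ≈ a u + s u * deg vs u
    diagonal rewrite entry-diag (u ∷ vs) a s u | adj-irrefl u = +-congˡ (*-congˡ (+-identityˡ _))

  D-delete : ∀ u a s → u ∉ vs → D (u ∷ vs) (a [ u ≔ 1# ]) (s [ u ≔ 0# ]) ≈ D vs (absorb u a s) s
  D-delete {vs} u a s u∉ = begin
    D (u ∷ vs) a₁ s₁
      ≈⟨ D-row a₁ s₁ u∉ ⟩
    a₁ u * D vs (absorb u a₁ s₁) s₁ + s₁ u * rest u vs a₁ s₁
      ≈⟨ +-cong (*-cong (reflexive (≔-here a u)) (D-cong vs (λ y∈ → absorb-cong u a₁ a s₁ s (same a y∈) (same s y∈)) (same s)))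
                (*-congʳ (reflexive (≔-here s u))) ⟩
    1# * D vs (absorb u a s) s + 0# * rest u vs a₁ s₁
      ≈⟨ +-cong (*-identityˡ _) (zeroˡ _) ⟩
    D vs (absorb u a s) s + 0#
      ≈⟨ +-identityʳ _ ⟩
    D vs (absorb u a s) s ∎
    where
    a₁ = a [ u ≔ 1# ]
    s₁ = s [ u ≔ 0# ]
    same : ∀ f {r y} → y ∈ vs → (f [ u ≔ r ]) y ≈ f y
    same f y∈ = reflexive (≔-there f (∉-≢ u∉ y∈))

  -- The determinant is affine in `a u`, with the principal minor at `u` as slope.
  D-bump : u ∉ vs → a′ u ≈ a u + s u → (∀ {y} → y ∈ vs → a′ y ≈ a y) →
           D (u ∷ vs) a′ s ≈ D (u ∷ vs) a s + s u * D vs (absorb u a′ s) s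
  D-bump {u} {vs} {a′} {a} {s} u∉ p same = begin
    D (u ∷ vs) a′ s
      ≈⟨ D-row a′ s u∉ ⟩
    a′ u * D vs (absorb u a′ s) s + s u * rest u vs a′ s
      ≈⟨ +-cong (*-congʳ p) (*-congˡ (rest-cong u vs same λ _ → refl)) ⟩
    (a u + s u) * D vs (absorb u a′ s) s + s u * rest u vs a s
      ≈⟨ solve 4 (λ a s d r → (a :+ s) :* d :+ s :* r := a :* d :+ s :* r :+ s :* d) refl _ _ _ _ ⟩
    a u * D vs (absorb u a′ s) s + s u * rest u vs a s + s u * D vs (absorb u a′ s) s
      ≈⟨ +-congʳ (+-congʳ (*-congˡ (D-cong vs (λ y∈ → absorb-cong u a′ a s s (same y∈) refl) λ _ → refl))) ⟩
    a u * D vs (absorb u a s) s + s u * rest u vs a s + s u * D vs (absorb u a′ s) s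
      ≈⟨ +-congʳ (D-row a s u∉) ⟨
    D (u ∷ vs) a s + s u * D vs (absorb u a′ s) s ∎

  Nonadjacent : A → List A → Set
  Nonadjacent w = All (λ v → adj w v ≡ false)

  deg-nonadjacent : Nonadjacent w vs → deg vs w ≈ 0#
  deg-nonadjacent []       = refl
  deg-nonadjacent (p ∷ ps) rewrite p = trans (+-identityˡ _) (deg-nonadjacent ps)

  -- Apart from the diagonal, row and column of `w` are nonzero only at `u`. Hence the coefficient
  -- of `s w` is the principal minor at `w` minus `s u` times the minor without `w` and `u`. By
  -- `D-bump` the subtracted term is precisely what the absorbed edge at `u` had added.
  D-leaf : ∀ a s → Unique (w ∷ u ∷ vs) → adj w u ≡ true → Nonadjacent w vs →
           D (w ∷ u ∷ vs) a s ≈ s w * D (u ∷ vs) a s + a w * D (u ∷ vs) (absorb w a s) s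
  D-leaf {w} {u} {vs} a s uniq@(_ ∷ uniq′) wu wvs = begin
    D (w ∷ u ∷ vs) a s
      ≈⟨ D-row a s w∉ ⟩
    a w * m + s w * rest w (u ∷ vs) a s
      ≈⟨ +-congˡ (*-congˡ rest≈) ⟩
    a w * m + s w * D (u ∷ vs) a s
      ≈⟨ +-comm _ _ ⟩
    s w * D (u ∷ vs) a s + a w * m ∎
    where
    w∉ = head∉ uniq
    u∉ = head∉ uniq′
    b = absorb w a s
    m = D (u ∷ vs) b s
    K = entry (u ∷ vs) b s
    uw = ≡.trans (adj-sym u w) wu
    vw : v ∈ vs → adj v w ≡ false
    vw v∈ = ≡.trans (adj-sym _ w) (All.lookup wvs v∈)

    degree≈ : deg (u ∷ vs) w ≈ 1#
    degree≈ rewrite wu = trans (+-congˡ (deg-nonadjacent wvs)) (+-identityʳ _)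

    minor : alt (λ z zs → ι (adj w z) * ldet K (u ∷ vs) (w ∷ zs)) (u ∷ vs) ≈ s u * D vs (absorb u b s) s
    minor = begin
      alt (λ z zs → ι (adj w z) * ldet K (u ∷ vs) (w ∷ zs)) (u ∷ vs)
        ≈⟨ alt-head _ (λ _ zs → ldet K (u ∷ vs) (w ∷ zs)) u vs (λ e∈ → reflexive (≡.cong ι (All.lookup wvs e∈))) ⟩
      ι (adj w u) * ldet K (u ∷ vs) (w ∷ vs)
        ≈⟨ trans (*-congʳ (reflexive (≡.cong ι wu))) (*-identityˡ _) ⟩
      ldet K (u ∷ vs) (w ∷ vs)
        ≈⟨ ldet-col-expand K (u ∷ vs) w vs ⟩
      alt (λ r rs → K r w * ldet K rs vs) (u ∷ vs)
        ≈⟨ alt-head _ (λ _ rs → ldet K rs vs) u vs (λ e∈ → entry-nonedge (u ∷ vs) b s (∉-≢ w∉ (there e∈)) (vw e∈)) ⟩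
      K u w * ldet K vs vs
        ≈⟨ *-cong (entry-edge (u ∷ vs) b s (∉-≢ w∉ (here ≡.refl)) uw) (ldet-absorb u vs b s vs vs) ⟩
      s u * D vs (absorb u b s) s ∎

    rest≈ : rest w (u ∷ vs) a s ≈ D (u ∷ vs) a s
    rest≈ = begin
      rest w (u ∷ vs) a s
        ≈⟨ sub-cong (trans (*-congʳ degree≈) (*-identityˡ m)) minor ⟩
      m - s u * D vs (absorb u b s) s
        ≈⟨ +-congʳ (D-bump u∉ (reflexive (absorb-edge a s uw)) λ y∈ → reflexive (absorb-nonedge a s (vw y∈))) ⟩
      D (u ∷ vs) a s + s u * D vs (absorb u b s) s - s u * D vs (absorb u b s) s
        ≈⟨ solve 2 (λ d m → d :+ m :- m := d) refl _ _ ⟩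
      D (u ∷ vs) a s ∎

  data InducedPath : List A → Set where
    single : InducedPath [ u ]
    cons   : adj w u ≡ true → Nonadjacent w vs → InducedPath (u ∷ vs) → InducedPath (w ∷ u ∷ vs)

  ∏ : (A → Carrier) → List A → Carrier
  ∏ s []       = 1#
  ∏ s (y ∷ ys) = s y * ∏ s ys

  signed-even : ∀ {n x} → Odd (suc n) → signed n x ≈ x
  signed-even odd1                    = refl
  signed-even {suc (suc n)} (odd+2 o) = trans (solve 1 (λ x → :- :- x := x) refl _) (signed-even o)

  module _ (us : List A) (a s : A → Carrier) where
    private K = entry us a s

    -- Pairing each row of an induced path with the column of the next vertex gives a lower
    -- triangular matrix, because a vertex has no later neighbour but the next. `path-upper` is the
    -- transposed situation. These minors are the terms running around the cycle in `D-cycle`.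
    path-lower : ∀ k q → Unique (k ∷ q ++ [ l ]) → InducedPath (k ∷ q ++ [ l ]) →
                 ldet K (k ∷ q) (q ++ [ l ]) ≈ ∏ s (k ∷ q)
    path-lower k [] uniq (cons kl _ _) = trans (alt-head (K k) (λ _ → ldet K []) _ [] λ ())
      (*-congʳ (entry-edge us a s (∉-≢ (head∉ uniq) (here ≡.refl) ∘ ≡.sym) kl))
    path-lower k (y ∷ q) uniq@(_ ∷ uniq′) (cons ky kq path) = trans
      (alt-head _ (λ _ → ldet K (y ∷ q)) y (q ++ [ _ ]) λ e∈ → entry-nonedge us a s
        (∉-≢ (head∉ uniq) (there e∈) ∘ ≡.sym) (All.lookup kq e∈))
      (*-cong (entry-edge us a s (∉-≢ (head∉ uniq) (here ≡.refl) ∘ ≡.sym) ky)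
              (path-lower y q uniq′ path))

    path-upper : ∀ k q → Unique (k ∷ q ++ [ l ]) → InducedPath (k ∷ q ++ [ l ]) →
                 ldet K (q ++ [ l ]) (k ∷ q) ≈ ∏ s (q ++ [ l ])
    path-upper k [] uniq (cons kl _ _) = trans (alt-head (λ c → K _ c) (λ _ → ldet K []) k [] λ ())
      (*-congʳ (entry-edge us a s (∉-≢ (head∉ uniq) (here ≡.refl)) (≡.trans (adj-sym _ k) kl)))
    path-upper k (y ∷ q) uniq@(_ ∷ uniq′) (cons ky kq path) = trans
      (ldet-col-expand K (y ∷ q ++ [ _ ]) k (y ∷ q)) (trans
      (alt-head _ (λ _ rs → ldet K rs (y ∷ q)) y (q ++ [ _ ]) λ e∈ → entry-nonedge us a s
        (∉-≢ (head∉ uniq) (there e∈)) (≡.trans (adj-sym _ k) (All.lookup kq e∈)))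
      (*-cong (entry-edge us a s (∉-≢ (head∉ uniq) (here ≡.refl)) (≡.trans (adj-sym _ k) ky))
              (path-upper y q uniq′ path)))

  -- The cycle opened at `w`, with neighbours `k` and `l` and the other vertices `q` between them.
  -- Its length is `3 + length q`, so odd girth means that `length q` is even, written here with
  -- `Odd`.
  record InducedCycle (w k : A) (q : List A) (l : A) : Set where
    constructor inducedCycle
    field
      uniq : Unique (w ∷ k ∷ q ++ [ l ])
      even : Odd (suc (length q))
      wk   : adj w k ≡ true
      wq   : Nonadjacent w q
      wl   : adj w l ≡ true
      path : InducedPath (k ∷ q ++ [ l ])

  -- The last two summands are the two orientations of the cycle; their sign is + because the cycle is odd.
  D-cycle : ∀ a s → InducedCycle w k q l → let P = k ∷ q ++ [ l ] in
    D (w ∷ P) a s ≈ a w * D P (absorb w a s) s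
      + s w * (D P (a [ l ≔ a l + s l ]) s + D P (a [ k ≔ a k + s k ]) s
               + (s l * ∏ s (k ∷ q) + s k * ∏ s (q ++ [ l ])))
  D-cycle {w} {k} {q} {l} a s (inducedCycle uniq@(_ ∷ uniq′@(_ ∷ uniq″)) even wk wq wl path) =
    trans (D-row a s w∉) (+-congˡ (*-congˡ rest≈))
    where
    P  = k ∷ q ++ [ l ]
    b  = absorb w a s
    m  = D P b s
    K  = entry P b s
    aˡ = a [ l ≔ a l + s l ]
    aᵏ = a [ k ≔ a k + s k ]
    mᵏ = D (q ++ [ l ]) (absorb k b s) s
    mˡ = D (k ∷ q) (absorb l b s) s
    w∉ = head∉ uniq
    k∉ = head∉ uniq′
    P↭ : P ↭ l ∷ k ∷ q
    P↭ = ++-comm (k ∷ q) [ l ]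
    l∈ : l ∈ q ++ [ l ]
    l∈ = ∈-++⁺ʳ q (here ≡.refl)

    last∉ : ∀ q → Unique (q ++ [ l ]) → l ∉ q
    last∉ (x ∷ q) u       (here ≡.refl) = head∉ u (∈-++⁺ʳ q (here ≡.refl))
    last∉ (x ∷ q) (_ ∷ u) (there l∈q)   = last∉ q u l∈q

    l∉ : l ∉ k ∷ q
    l∉ (here ≡.refl) = k∉ l∈
    l∉ (there l∈q)   = last∉ q uniq″ l∈q

    kw = ≡.trans (adj-sym k w) wk
    lw = ≡.trans (adj-sym l w) wl
    qw : y ∈ q → adj y w ≡ false
    qw y∈ = ≡.trans (adj-sym _ w) (All.lookup wq y∈)

    b≈aˡ : y ∈ q ++ [ l ] → b y ≈ aˡ y
    b≈aˡ y∈ with ∈-++⁻ q y∈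
    ... | inj₁ y∈q           = reflexive (≡.trans (absorb-nonedge a s (qw y∈q))
                                 (≡.sym (≔-there a (∉-≢ l∉ (there y∈q)))))
    ... | inj₂ (here ≡.refl) = reflexive (≡.trans (absorb-edge a s lw) (≡.sym (≔-here a l)))

    b≈aᵏ : y ∈ k ∷ q → b y ≈ aᵏ y
    b≈aᵏ (here ≡.refl) = reflexive (≡.trans (absorb-edge a s kw) (≡.sym (≔-here a k)))
    b≈aᵏ (there y∈)    = reflexive (≡.trans (absorb-nonedge a s (qw y∈))
                           (≡.sym (≔-there a (∉-≢ k∉ (∈-++⁺ˡ y∈)))))

    -- `b` has absorbed `w` at both ends of the path, `aˡ` only at `l`. Restoring the difference at
    -- `k` costs a principal minor; `m-at-l` does the same at the other end.
    m-at-k : m ≈ D P aˡ s + s k * mᵏ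
    m-at-k = D-bump k∉
      (reflexive (≡.trans (absorb-edge a s kw)
        (≡.cong (_+ s k) (≡.sym (≔-there a (∉-≢ l∉ (here ≡.refl)))))))
      b≈aˡ

    m-at-l : m ≈ D P aᵏ s + s l * mˡ
    m-at-l = begin
      D P b s                       ≈⟨ D-perm b s P↭ ⟩
      D (l ∷ k ∷ q) b s             ≈⟨ D-bump l∉ (reflexive (≡.trans (absorb-edge a s lw)
                                         (≡.cong (_+ s l) (≡.sym (≔-there a (∉-≢ k∉ l∈)))))) b≈aᵏ ⟩
      D (l ∷ k ∷ q) aᵏ s + s l * mˡ ≈⟨ +-congʳ (D-perm aᵏ s P↭) ⟨
      D P aᵏ s + s l * mˡ           ∎

    degree≈ : ∀ q → Nonadjacent w q → deg (q ++ [ l ]) w ≈ 1#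
    degree≈ []      []       rewrite wl = +-identityʳ _
    degree≈ (x ∷ q) (p ∷ wq) rewrite p = trans (+-identityˡ _) (degree≈ q wq)

    column : ∀ cs → ldet K P (w ∷ cs) ≈ s k * ldet K (q ++ [ l ]) cs - s l * ldet K (k ∷ q) cs
    column cs = begin
      ldet K P (w ∷ cs)
        ≈⟨ ldet-col-expand K P w cs ⟩
      K k w * ldet K (q ++ [ l ]) cs - alt (λ r rs → K r w * ldet K (k ∷ rs) cs) (q ++ [ l ])
        ≈⟨ sub-cong (*-congʳ (entry-edge P b s (∉-≢ w∉ (here ≡.refl)) kw))
             (trans (alt-last _ _ q l λ e∈ → entry-nonedge P b s
                 (∉-≢ w∉ (there (∈-++⁺ˡ e∈))) (qw e∈))
             (trans (signed-even even)
               (*-congʳ (entry-edge P b s (∉-≢ w∉ (there l∈)) lw)))) ⟩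
      s k * ldet K (q ++ [ l ]) cs - s l * ldet K (k ∷ q) cs ∎

    -- Expanding along row and column of `w` selects a neighbour twice. Equal choices give principal
    -- minors, different choices give triangular ones; the evenness of `length q` fixes the signs.
    minors : alt (λ z zs → ι (adj w z) * ldet K P (w ∷ zs)) P ≈
             (s k * mᵏ - s l * ∏ s (k ∷ q)) - (s k * ∏ s (q ++ [ l ]) - s l * mˡ)
    minors = begin
      ι (adj w k) * ldet K P (w ∷ q ++ [ l ]) - alt (λ z zs → ι (adj w z) * ldet K P (w ∷ k ∷ zs)) (q ++ [ l ])
        ≈⟨ sub-cong (trans (*-congʳ (reflexive (≡.cong ι wk))) (*-identityˡ _))
             (trans (alt-last _ _ q l λ e∈ → reflexive (≡.cong ι (All.lookup wq e∈)))
             (trans (signed-even even)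
               (trans (*-congʳ (reflexive (≡.cong ι wl))) (*-identityˡ _)))) ⟩
      ldet K P (w ∷ q ++ [ l ]) - ldet K P (w ∷ k ∷ q)
        ≈⟨ sub-cong (column (q ++ [ l ])) (column (k ∷ q)) ⟩
      (s k * ldet K (q ++ [ l ]) (q ++ [ l ]) - s l * ldet K (k ∷ q) (q ++ [ l ]))
        - (s k * ldet K (q ++ [ l ]) (k ∷ q) - s l * ldet K (k ∷ q) (k ∷ q))
        ≈⟨ sub-cong
             (sub-cong (*-congˡ (ldet-absorb k (q ++ [ l ]) b s (q ++ [ l ]) (q ++ [ l ])))
                       (*-congˡ (path-lower P b s k q uniq′ path)))
             (sub-cong (*-congˡ (path-upper P b s k q uniq′ path))
                       (*-congˡ (trans (ldet-cong (k ∷ q) (k ∷ q) λ _ _ → entry-perm b s _ _ P↭)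
                                       (ldet-absorb l (k ∷ q) b s (k ∷ q) (k ∷ q))))) ⟩
      (s k * mᵏ - s l * ∏ s (k ∷ q)) - (s k * ∏ s (q ++ [ l ]) - s l * mˡ) ∎

    rest≈ : rest w P a s ≈ D P aˡ s + D P aᵏ s + (s l * ∏ s (k ∷ q) + s k * ∏ s (q ++ [ l ]))
    rest≈ = begin
      rest w P a s
        ≈⟨ sub-cong (*-congʳ (+-cong (reflexive (≡.cong ι wk)) (degree≈ q wq))) minors ⟩
      -- The vertex `w` has degree two, so there is one copy of `m` to cancel each of the two
      -- principal minors.
      (1# + 1#) * m - ((s k * mᵏ - s l * ∏ s (k ∷ q)) - (s k * ∏ s (q ++ [ l ]) - s l * mˡ))
        ≈⟨ solve 5 (λ m x y z t → (:1 :+ :1) :* m :- ((x :- y) :- (z :- t)) := (m :- x) :+ (m :- t) :+ (y :+ z))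
             refl _ _ _ _ _ ⟩
      (m - s k * mᵏ) + (m - s l * mˡ) + (s l * ∏ s (k ∷ q) + s k * ∏ s (q ++ [ l ]))
        ≈⟨ +-congʳ (+-cong (sub-cong m-at-k refl) (sub-cong m-at-l refl)) ⟩
      (D P aˡ s + s k * mᵏ - s k * mᵏ) + (D P aᵏ s + s l * mˡ - s l * mˡ)
        + (s l * ∏ s (k ∷ q) + s k * ∏ s (q ++ [ l ]))
        ≈⟨ +-congʳ (+-cong cancel cancel) ⟩
      D P aˡ s + D P aᵏ s + (s l * ∏ s (k ∷ q) + s k * ∏ s (q ++ [ l ])) ∎
      where
      cancel : ∀ {d m} → d + m - m ≈ d
      cancel = solve 2 (λ d m → d :+ m :- m := d) refl _ _

-- Positive cones and the explicit polynomials of paths, odd cycles and stars.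

record PositiveCone {c ℓ} (R : CommutativeRing c ℓ) : Set (c Level.⊔ Level.suc ℓ) where
  open CommutativeRing R
  field
    Pos      : Carrier → Set ℓ
    Pos-resp : ∀ {p q} → p ≈ q → Pos p → Pos q
    Pos-0    : Pos 0#
    Pos-1    : Pos 1#
    Pos-+    : ∀ {p q} → Pos p → Pos q → Pos (p + q)
    Pos-*    : ∀ {p q} → Pos p → Pos q → Pos (p * q)

module Bounds {c ℓ} (R : CommutativeRing c ℓ) (cone : PositiveCone R)
  (x : CommutativeRing.Carrier R) (Pos-x : PositiveCone.Pos cone x) where

  open CommutativeRing R
  open PositiveCone cone
  open RingSolver R
  open import Relation.Binary.Reasoning.Setoid setoid

  infix 4 _≼_
  _≼_ : Carrier → Carrier → Set (c Level.⊔ ℓ)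
  p ≼ q = ∃[ r ] Pos r × q ≈ p + r

  ≼-reflexive : ∀ {p q} → p ≈ q → p ≼ q
  ≼-reflexive p≈q = 0# , Pos-0 , trans (sym p≈q) (sym (+-identityʳ _))

  ≼-trans : ∀ {p q r} → p ≼ q → q ≼ r → p ≼ r
  ≼-trans (d , pd , e) (d′ , pd′ , e′) =
    d + d′ , Pos-+ pd pd′ , trans e′ (trans (+-congʳ e) (+-assoc _ _ _))

  ≼-respʳ : ∀ {p q r} → q ≈ r → p ≼ q → p ≼ r
  ≼-respʳ q≈r (d , pd , e) = d , pd , trans (sym q≈r) e

  ≼-+ : ∀ {p q p′ q′} → p ≼ q → p′ ≼ q′ → p + p′ ≼ q + q′
  ≼-+ (d , pd , e) (d′ , pd′ , e′) = d + d′ , Pos-+ pd pd′ , trans (+-cong e e′)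
    (solve 4 (λ a b c d → (a :+ b) :+ (c :+ d) := (a :+ c) :+ (b :+ d)) refl _ _ _ _)

  ≼-* : ∀ {k p q} → Pos k → p ≼ q → k * p ≼ k * q
  ≼-* {k} pk (d , pd , e) = k * d , Pos-* pk pd , trans (*-congˡ e) (distribˡ _ _ _)

  ≼-+Pos : ∀ {p r} → Pos r → p ≼ p + r
  ≼-+Pos pr = _ , pr , refl

  Pos-1+x : Pos (1# + x)
  Pos-1+x = Pos-+ Pos-1 Pos-x

  -- det(xI + Q) for a path on h vertices with one additional loop at one end (τ h)
  -- or at both ends (ρ h).
  ρ τ : ℕ → Carrier
  ρ zero    = 1#
  ρ (suc h) = τ h + (1# + x) * ρ h
  τ zero    = 1#
  τ (suc h) = τ h + x * ρ h

  Pos-ρ : ∀ h → Pos (ρ h)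
  Pos-τ : ∀ h → Pos (τ h)
  Pos-ρ zero    = Pos-1
  Pos-ρ (suc h) = Pos-+ (Pos-τ h) (Pos-* Pos-1+x (Pos-ρ h))
  Pos-τ zero    = Pos-1
  Pos-τ (suc h) = Pos-+ (Pos-τ h) (Pos-* Pos-x (Pos-ρ h))

  -- In terms of paths: a second end loop adds the minor without that end vertex, and there the edge
  -- to the removed vertex survives as a loop on the new end.
  ρ-suc : ∀ h → ρ (suc h) ≈ τ (suc h) + ρ h
  ρ-suc h = solve 3 (λ t x r → t :+ (:1 :+ x) :* r := (t :+ x :* r) :+ r) refl _ _ _

  -- f of the cycle on h + 1 vertices, for even h.
  oddCycle : ℕ → Carrier
  oddCycle h = x * ρ h + ((τ h + τ h) + (1# + 1#))

  -- ψ (at the vertex of maximal degree) and f of the triangle with m pendent edges at one vertex.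
  starRoot star : ℕ → Carrier
  starRoot zero    = ρ 2
  starRoot (suc m) = (1# + x) * starRoot m
  star zero    = oddCycle 2
  star (suc m) = (1# + x) * star m + x * starRoot m

  starRoot≼ρ : ∀ m → starRoot m ≼ ρ (2 ℕ.+ m)
  starRoot≼ρ zero    = ≼-reflexive refl
  starRoot≼ρ (suc m) = ≼-trans (≼-* Pos-1+x (starRoot≼ρ m)) (≼-respʳ (+-comm _ _) (≼-+Pos (Pos-τ (2 ℕ.+ m))))

  -- The constant 2 is the contribution of the two orientations in `oddCycle`. The factor `1# + x`
  -- in the recursion of `star` multiplies it as well, and the resulting 2x has to be paid for by x
  -- times a value of `ρ`.
  2≼ρ : ∀ h → 1# + 1# ≼ ρ (suc h)
  2≼ρ zero    = x , Pos-x , solve 1 (λ x → :1 :+ (:1 :+ x) :* :1 := (:1 :+ :1) :+ x) refl x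
  2≼ρ (suc h) = ≼-trans (2≼ρ h) (≼-respʳ (trans (+-comm _ _) (sym (ρ-suc (suc h)))) (≼-+Pos (Pos-τ (suc (suc h)))))

  -- The induction adds one vertex at a time, so it also passes through odd arguments of `oddCycle`,
  -- where the formula is not the polynomial of a cycle but the inequality holds all the same.
  star≼oddCycle : ∀ m → star m ≼ oddCycle (2 ℕ.+ m)
  star≼oddCycle zero    = ≼-reflexive refl
  star≼oddCycle (suc m) with 2≼ρ m
  ... | d , pd , e = ≼-respʳ (sym growth)
    (≼-trans (≼-+ (≼-* Pos-1+x (star≼oddCycle m)) (≼-* Pos-x (starRoot≼ρ m))) (≼-+Pos (Pos-* Pos-x pd)))
    where
    h = suc m
    growth : oddCycle (2 ℕ.+ h) ≈ (1# + x) * oddCycle (1 ℕ.+ h) + x * ρ (1 ℕ.+ h) + x * d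
    growth = begin
      x * (t + (1# + x) * r) + (((t + x * r) + (t + x * r)) + (1# + 1#))
        ≈⟨ +-congʳ (*-congˡ (+-congˡ (distribʳ _ _ _))) ⟩
      x * (t + (1# * r + x * r)) + (((t + x * r) + (t + x * r)) + (1# + 1#))
        -- Splitting only one of the occurrences of `r` exposes the surplus x (ρ h - 2), which is
        -- `x * d`.
        ≈⟨ +-congˡ (+-congʳ (+-congˡ (+-congˡ (*-congˡ split)))) ⟩
      x * (t + (1# * r + x * r)) + (((t + x * r) + (t + x * (t + (1# + 1# + d)))) + (1# + 1#))
        ≈⟨ solve 4 (λ x t r d →
             x :* (t :+ (:1 :* r :+ x :* r)) :+ (((t :+ x :* r) :+ (t :+ x :* (t :+ (:1 :+ :1 :+ d)))) :+ (:1 :+ :1))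
             := (:1 :+ x) :* (x :* r :+ ((t :+ t) :+ (:1 :+ :1))) :+ x :* r :+ x :* d) refl _ _ _ _ ⟩
      (1# + x) * (x * r + ((t + t) + (1# + 1#))) + x * r + x * d ∎
      where
      r = ρ (suc h)
      t = τ (suc h)
      split : r ≈ t + (1# + 1# + d)
      split = trans (ρ-suc h) (+-congˡ e)

  -- Evaluation and positivity for paths and cycles.

  module Graph {A : Set} (_≟_ : DecidableEquality A)
    (adj : A → A → Bool) (adj-sym : ∀ u v → adj u v ≡ adj v u) (adj-irrefl : ∀ v → adj v v ≡ false) where

    open WeightedGraph R _≟_ adj adj-sym adj-irrefl

    private variable
      u v w y k l : A
      vs xs ys q : List A
      a a′ s s′ : A → Carrier
      m : ℕ

    x̂ 1̂ : A → Carrier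
    x̂ = const x
    1̂ = const 1#

    bump : A → (A → Carrier) → A → Carrier
    bump u a = a [ u ≔ a u + 1# ]

    bump-cong : ∀ u → a u ≈ a′ u → a y ≈ a′ y → bump u a y ≈ bump u a′ y
    bump-cong {y = y} u p q with does (y ≟ u)
    ... | true  = +-congʳ p
    ... | false = q

    bump-fresh : ∀ a → u ∉ vs → y ∈ vs → bump u a y ≈ a y
    bump-fresh a u∉ y∈ = reflexive (≔-there a (∉-≢ u∉ y∈))

    D-single : ∀ l a s → D [ l ] a s ≈ a l
    D-single l a s = trans (D-row {vs = []} a s λ ())
      (solve 2 (λ a s → a :* :1 :+ s :* (con (0 , 0) :* :1 :- con (0 , 0)) := a) refl _ _)

    first : List A → A → A
    first []      l = l
    first (y ∷ _) l = y

    first∈ : ∀ q → first q l ∈ q ++ [ l ]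
    first∈ []      = here ≡.refl
    first∈ (y ∷ q) = here ≡.refl

    path-tail : ∀ q → InducedPath (w ∷ q ++ [ l ]) → InducedPath (q ++ [ l ])
    path-tail []      (cons _ _ p) = p
    path-tail (y ∷ q) (cons _ _ p) = p

    path-absorb : ∀ q a s → InducedPath (w ∷ q ++ [ l ]) → Unique (q ++ [ l ]) → y ∈ q ++ [ l ] →
                  absorb w a s y ≈ (a [ first q l ≔ a (first q l) + s (first q l) ]) y
    path-absorb {w} {l} {y} q a s path uniq y∈ = go q path uniq y∈
      where
      at-first : adj w u ≡ true → absorb w a s u ≈ (a [ u ≔ a u + s u ]) u
      at-first {u} wu = reflexive (≡.trans (absorb-edge a s (≡.trans (adj-sym u w) wu)) (≡.sym (≔-here a u)))
      go : ∀ q → InducedPath (w ∷ q ++ [ l ]) → Unique (q ++ [ l ]) → y ∈ q ++ [ l ] →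
           absorb w a s y ≈ (a [ first q l ≔ a (first q l) + s (first q l) ]) y
      go []      (cons wl _ _)   _ (here ≡.refl) = at-first wl
      go (u ∷ q) (cons wu _ _)   _ (here ≡.refl) = at-first wu
      go (u ∷ q) (cons _ wq _) uniq (there y∈)    = reflexive (≡.trans
        (absorb-nonedge a s (≡.trans (adj-sym y w) (All.lookup wq y∈)))
        (≡.sym (≔-there a (∉-≢ (head∉ uniq) y∈))))

    D-path : ∀ q a s → Unique (w ∷ q ++ [ l ]) → InducedPath (w ∷ q ++ [ l ]) →
             D (w ∷ q ++ [ l ]) a s ≈
             s w * D (q ++ [ l ]) a s + a w * D (q ++ [ l ]) (a [ first q l ≔ a (first q l) + s (first q l) ]) s
    D-path {w} {l} q a s uniq@(_ ∷ uniq′) path = trans (leaf q uniq path)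
      (+-congˡ (*-congˡ (D-cong (q ++ [ l ]) (path-absorb q a s path uniq′) λ _ → refl)))
      where
      leaf : ∀ q → Unique (w ∷ q ++ [ l ]) → InducedPath (w ∷ q ++ [ l ]) →
             D (w ∷ q ++ [ l ]) a s ≈ s w * D (q ++ [ l ]) a s + a w * D (q ++ [ l ]) (absorb w a s) s
      leaf []      uniq (cons wl wq _) = D-leaf a s uniq wl wq
      leaf (u ∷ q) uniq (cons wu wq _) = D-leaf a s uniq wu wq

    module _ {p l q} (uniq : Unique (p ∷ q ++ [ l ])) (path : InducedPath (p ∷ q ++ [ l ])) where
      private P = q ++ [ l ]

      D-path₁ : ∀ a → D (p ∷ P) a 1̂ ≈ D P a 1̂ + a p * D P (bump (first q l) a) 1̂
      D-path₁ a = trans (D-path q a 1̂ uniq path) (+-congʳ (*-identityˡ _))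

      D-path₂ : ∀ a → D (p ∷ P) (bump p a) 1̂ ≈ D P a 1̂ + (a p + 1#) * D P (bump (first q l) a) 1̂
      D-path₂ a = trans (D-path₁ (bump p a)) (+-cong
        (D-cong P fresh λ _ → refl)
        (*-cong (reflexive (≔-here a p))
          (D-cong P (λ y∈ → bump-cong (first q l) (fresh (first∈ q)) (fresh y∈)) λ _ → refl)))
        where
        fresh : y ∈ P → bump p a y ≈ a y
        fresh = bump-fresh a (head∉ uniq)

    -- Peeling off the first vertex puts a loop on its successor: `none` and `left` reduce to each
    -- other, as do `right` and `both`. The four values are therefore computed together.
    record PathValues (q : List A) (l : A) : Set ℓ where
      field
        none  : D (q ++ [ l ]) x̂ 1̂ ≈ x * ρ (length q)
        left  : D (q ++ [ l ]) (bump (first q l) x̂) 1̂ ≈ τ (suc (length q))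
        right : D (q ++ [ l ]) (bump l x̂) 1̂ ≈ τ (suc (length q))
        both  : D (q ++ [ l ]) (bump (first q l) (bump l x̂)) 1̂ ≈ ρ (suc (length q))

    pathValues : ∀ q → Unique (q ++ [ l ]) → InducedPath (q ++ [ l ]) → PathValues q l
    pathValues {l} [] uniq path = record
      { none  = trans (D-single l x̂ 1̂) (sym (*-identityʳ x))
      ; left  = end
      ; right = end
      -- On a single vertex the two ends coincide, so it carries two loops and the value is x + 2.
      ; both  = trans (D-single l (bump l (bump l x̂)) 1̂)
          (trans (reflexive (≡.trans (≔-here (bump l x̂) l) (≡.cong (_+ 1#) (≔-here x̂ l))))
          (solve 1 (λ x → x :+ :1 :+ :1 := :1 :+ (:1 :+ x) :* :1) refl x))
      }
      where
      end : D [ l ] (bump l x̂) 1̂ ≈ τ 1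
      end = trans (D-single l (bump l x̂) 1̂) (trans (reflexive (≔-here x̂ l))
        (solve 1 (λ x → x :+ :1 := :1 :+ x :* :1) refl x))
    pathValues {l} (p ∷ q) uniq@(_ ∷ uniq′) path = record
      { none  = trans (D-path₁ uniq path x̂) (trans (+-cong IH.none (*-congˡ IH.left))
          (trans (solve 3 (λ x r t → x :* r :+ x :* t := x :* (t :+ r)) refl _ _ _)
            (*-congˡ (sym (ρ-suc (length q))))))
      ; left  = trans (D-path₂ uniq path x̂) (trans (+-cong IH.none (*-congˡ IH.left))
          (trans (solve 3 (λ x r t → x :* r :+ (x :+ :1) :* t := t :+ x :* (t :+ r)) refl _ _ _)
            (+-congˡ (*-congˡ (sym (ρ-suc (length q)))))))
      ; right = trans (D-path₁ uniq path (bump l x̂)) (+-cong IH.right (*-cong pl IH.both))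
      ; both  = trans (D-path₂ uniq path (bump l x̂))
          (+-cong IH.right (*-cong (trans (+-congʳ pl) (+-comm x 1#)) IH.both))
      }
      where
      module IH = PathValues (pathValues {l} q uniq′ (path-tail q path))
      pl : bump l x̂ p ≈ x
      pl = reflexive (≔-there x̂ λ { ≡.refl → head∉ uniq (∈-++⁺ʳ q (here ≡.refl)) })

    Positive : (A → Carrier) → Set ℓ
    Positive f = ∀ y → Pos (f y)

    Pos-≔ : Positive a → ∀ u {r} → Pos r → Positive (a [ u ≔ r ])
    Pos-≔ pa u pr y with does (y ≟ u)
    ... | true  = pr
    ... | false = pa y

    Pos-absorb : ∀ w → Positive a → Positive s → Positive (absorb w a s)
    Pos-absorb w pa ps y with adj y w
    ... | true  = Pos-+ (pa y) (ps y)
    ... | false = pa y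

    Pos-∏ : Positive s → ∀ ys → Pos (∏ s ys)
    Pos-∏ ps []       = Pos-1
    Pos-∏ ps (y ∷ ys) = Pos-* (ps y) (Pos-∏ ps ys)

    Pos-x̂ : Positive x̂
    Pos-x̂ _ = Pos-x

    Pos-1̂ : Positive 1̂
    Pos-1̂ _ = Pos-1

    Pos-path : ∀ q → Unique (q ++ [ l ]) → InducedPath (q ++ [ l ]) → Positive a → Positive s →
               Pos (D (q ++ [ l ]) a s)
    Pos-path {l} {a} {s} [] uniq path pa ps = Pos-resp (sym (D-single l a s)) (pa l)
    Pos-path {l} {a} {s} (p ∷ q) uniq@(_ ∷ uniq′) path pa ps = Pos-resp (sym (D-path q a s uniq path))
      (Pos-+ (Pos-* (ps p) (Pos-path q uniq′ path′ pa ps))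
             (Pos-* (pa p) (Pos-path q uniq′ path′ (Pos-≔ pa (first q l) (Pos-+ (pa _) (ps _))) ps)))
      where path′ = path-tail q path

    Pos-cycle : InducedCycle w k q l → Positive a → Positive s → Pos (D (w ∷ k ∷ q ++ [ l ]) a s)
    Pos-cycle {w} {k} {q} {l} {a} {s} cyc@(inducedCycle (_ ∷ uniq) _ _ _ _ path) pa ps =
      Pos-resp (sym (D-cycle a s cyc))
        (Pos-+ (Pos-* (pa w) (Pos-P (Pos-absorb w pa ps)))
               (Pos-* (ps w) (Pos-+ (Pos-+ (Pos-P (Pos-≔ pa l (Pos-+ (pa l) (ps l))))
                                           (Pos-P (Pos-≔ pa k (Pos-+ (pa k) (ps k)))))
                                    (Pos-+ (Pos-* (ps l) (Pos-∏ ps (k ∷ q))) (Pos-* (ps k) (Pos-∏ ps (q ++ [ l ])))))))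
      where
      Pos-P : ∀ {b} → Positive b → Pos (D (k ∷ q ++ [ l ]) b s)
      Pos-P pb = Pos-path (k ∷ q) uniq path pb ps

    f : List A → Carrier
    f vs = D vs x̂ 1̂

    ψ : A → List A → Carrier
    ψ u vs = D vs (x̂ [ u ≔ 1# ]) (1̂ [ u ≔ 0# ])

    ∏-1̂ : ∀ ys → ∏ 1̂ ys ≈ 1#
    ∏-1̂ []       = refl
    ∏-1̂ (y ∷ ys) = trans (*-identityˡ _) (∏-1̂ ys)

    module _ (cyc : InducedCycle w k q l) where
      open InducedCycle cyc
      private
        P : List A
        P = k ∷ q ++ [ l ]
        uniq′ : Unique P
        uniq′ = AllPairs.tail uniq
        module V = PathValues (pathValues (k ∷ q) uniq′ path)
        l≢k : l ≢ k
        l≢k = ∉-≢ (head∉ uniq′) (∈-++⁺ʳ q (here ≡.refl))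

        ends : y ∈ P → absorb w x̂ 1̂ y ≈ bump k (bump l x̂) y
        ends (here ≡.refl) = reflexive (≡.trans (absorb-edge x̂ 1̂ (≡.trans (adj-sym k w) wk))
          (≡.sym (≡.trans (≔-here (bump l x̂) k) (≡.cong (_+ 1#) (≔-there x̂ (l≢k ∘ ≡.sym))))))
        ends {y} (there y∈) = trans inner
          (sym (bump-fresh (bump l x̂) (head∉ uniq′) y∈))
          where
          inner : absorb w x̂ 1̂ y ≈ bump l x̂ y
          inner with y ≟ l | ∈-++⁻ q y∈
          ... | yes ≡.refl | _        = reflexive (absorb-edge x̂ 1̂ (≡.trans (adj-sym l w) wl))
          ... | no y≢l | inj₁ y∈q     = reflexive (absorb-nonedge x̂ 1̂ (≡.trans (adj-sym y w) (All.lookup wq y∈q)))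
          ... | no y≢l | inj₂ (here e) = contradiction e y≢l

        D-ends : D P (absorb w x̂ 1̂) 1̂ ≈ ρ (2 ℕ.+ length q)
        D-ends = trans (D-cong P ends λ _ → refl) V.both

      ψ-cycle : ψ w (w ∷ P) ≈ ρ (2 ℕ.+ length q)
      ψ-cycle = trans (D-delete w x̂ 1̂ (head∉ uniq)) D-ends

      f-cycle : f (w ∷ P) ≈ oddCycle (2 ℕ.+ length q)
      f-cycle = trans (D-cycle x̂ 1̂ cyc) (+-cong (*-congˡ D-ends) (trans (*-identityˡ _)
        (+-cong (+-cong V.right V.left)
          (+-cong (trans (*-identityˡ _) (∏-1̂ (k ∷ q))) (trans (*-identityˡ _) (∏-1̂ (q ++ [ l ])))))))

    -- Attaching pendent vertices and the two inductive bounds.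

    record Pendant (w u : A) (vs : List A) : Set where
      constructor pendant
      field
        uniq : Unique (w ∷ u ∷ vs)
        wu   : adj w u ≡ true
        wvs  : Nonadjacent w vs

      w∉ : w ∉ u ∷ vs
      w∉ = head∉ uniq

      u∉ : u ∉ vs
      u∉ = head∉ (AllPairs.tail uniq)

      D-pendant : ∀ a s → D (w ∷ u ∷ vs) a s ≈ s w * D (u ∷ vs) a s + a w * D (u ∷ vs) (absorb w a s) s
      D-pendant a s = D-leaf a s uniq wu wvs

      same : ∀ a s → y ∈ vs → absorb w a s y ≈ a y
      same a s y∈ = reflexive (absorb-nonedge a s (≡.trans (adj-sym _ w) (All.lookup wvs y∈)))

      -- The minor at `u` is written with the weights (1 , 0) on the unchanged list `u ∷ vs`:
      -- dropping `u` from the list could destroy the cycle or the connectedness on which `Pos-D`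
      -- relies.
      D-absorb : ∀ a s → D (u ∷ vs) (absorb w a s) s ≈
                 D (u ∷ vs) a s + s u * D (u ∷ vs) (a [ u ≔ 1# ]) (s [ u ≔ 0# ])
      D-absorb a s = trans (D-bump u∉ (reflexive (absorb-edge a s (≡.trans (adj-sym u w) wu))) (same a s))
        (+-congˡ (*-congˡ (trans
          (D-cong vs (λ y∈ → absorb-cong u (absorb w a s) a s s (same a s y∈) refl) λ _ → refl)
          (sym (D-delete u a s u∉)))))

      f-pendant : f (w ∷ u ∷ vs) ≈ (1# + x) * f (u ∷ vs) + x * ψ u (u ∷ vs)
      f-pendant = trans (D-pendant x̂ 1̂) (trans (+-congˡ (*-congˡ (D-absorb x̂ 1̂)))
        (solve 3 (λ x f p → :1 :* f :+ x :* (f :+ :1 :* p) := (:1 :+ x) :* f :+ x :* p) refl _ _ _))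

      -- The factor `sᵛ u` is zero for u = v and one otherwise. It lets one formula serve both the
      -- attachment vertex, where the extra term vanishes, and all other old vertices.
      ψ-pendant : v ∈ u ∷ vs → let aᵛ = x̂ [ v ≔ 1# ]; sᵛ = 1̂ [ v ≔ 0# ] in
        ψ v (w ∷ u ∷ vs) ≈
        (1# + x) * ψ v (u ∷ vs) + x * (sᵛ u * D (u ∷ vs) (aᵛ [ u ≔ 1# ]) (sᵛ [ u ≔ 0# ]))
      ψ-pendant {v} v∈ = trans (D-pendant _ _) (trans
        (+-cong (*-congʳ (reflexive (≔-there 1̂ w≢v))) (*-cong (reflexive (≔-there x̂ w≢v)) (D-absorb _ _)))
        (solve 3 (λ x p r → :1 :* p :+ x :* (p :+ r) := (:1 :+ x) :* p :+ x :* r) refl _ _ _))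
        where
        w≢v : w ≢ v
        w≢v = ∉-≢ w∉ v∈ ∘ ≡.sym

    -- The index is the number of vertices minus 3.
    data OddUnicyclic : ℕ → List A → Set where
      cycle : InducedCycle w k q l →
              (∀ {u} → u ∈ w ∷ k ∷ q ++ [ l ] → ∃[ k′ ] ∃[ q′ ] ∃[ l′ ]
                 u ∷ k′ ∷ q′ ++ [ l′ ] ↭ w ∷ k ∷ q ++ [ l ] × InducedCycle u k′ q′ l′ × length q′ ≡ length q) →
              OddUnicyclic (length q) (w ∷ k ∷ q ++ [ l ])
      leaf  : Pendant w u vs → OddUnicyclic m (u ∷ vs) → OddUnicyclic (suc m) (w ∷ u ∷ vs)
      perm  : xs ↭ ys → OddUnicyclic m xs → OddUnicyclic m ys

    -- Arbitrary weights keep the induction going, since removing a leaf replaces `a` by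
    -- `absorb w a s`; all terms of `D-leaf` and `D-cycle` enter with a plus sign.
    Pos-D : OddUnicyclic m vs → Positive a → Positive s → Pos (D vs a s)
    Pos-D (cycle cyc _) pa ps = Pos-cycle cyc pa ps
    Pos-D {a = a} {s = s} (leaf {w = w} pend G) pa ps =
      Pos-resp (sym (Pendant.D-pendant pend a s))
        (Pos-+ (Pos-* (ps w) (Pos-D G pa ps)) (Pos-* (pa w) (Pos-D G (Pos-absorb w pa ps) ps)))
    Pos-D (perm p G) pa ps = Pos-resp (D-perm _ _ p) (Pos-D G pa ps)

    ψ-bound : OddUnicyclic m vs → v ∈ vs → starRoot m ≼ ψ v vs
    -- The cycle is reopened at the given vertex, so that `ψ-cycle` applies to it; its length, and
    -- with it the index of `ρ`, is unchanged.
    ψ-bound (cycle {q = q} _ rotated) v∈ with rotated v∈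
    ... | k′ , q′ , l′ , p , cyc , e = ≼-respʳ
      (trans (reflexive (≡.cong (λ n → ρ (2 ℕ.+ n)) (≡.sym e))) (trans (sym (ψ-cycle cyc)) (D-perm _ _ p)))
      (starRoot≼ρ (length q))
    -- At the new vertex `w` the comparison is with ψ at its neighbour: deleting `w` leaves a loop
    -- on `u`, which gives f + ψ at `u`, and f in turn contains x ψ.
    ψ-bound (leaf {w} {u} {vs} {m} pend G) (here ≡.refl) = ≼-respʳ (sym ψ≈)
      (≼-trans (≼-* Pos-1+x (ψ-bound G (here ≡.refl))) (≼-+Pos (Pos-D G (Pos-≔ Pos-x̂ u Pos-0) (Pos-≔ Pos-1̂ u Pos-1))))
      where
      open Pendant pend
      P = u ∷ vs
      -- Linearity in the row of `u`: the weights (x , 1) are x times (1 , 0) plus (0 , 1), and the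
      -- second part is a determinant with nonnegative weights.
      f≈ : f P ≈ x * ψ u P + D P (x̂ [ u ≔ 0# ]) (1̂ [ u ≔ 1# ])
      f≈ = trans (D-row x̂ 1̂ u∉) (+-cong (*-congˡ (sym (D-delete u x̂ 1̂ u∉)))
        (sym (trans (D-row _ _ u∉) (trans
          (+-cong (trans (*-congʳ (reflexive (≔-here x̂ u))) (zeroˡ _))
                  (*-cong (reflexive (≔-here 1̂ u)) (rest-cong u vs
                    (λ y∈ → reflexive (≔-there x̂ (∉-≢ u∉ y∈))) (λ y∈ → reflexive (≔-there 1̂ (∉-≢ u∉ y∈))))))
          (+-identityˡ _)))))
      ψ≈ : ψ w (w ∷ P) ≈ (1# + x) * ψ u P + D P (x̂ [ u ≔ 0# ]) (1̂ [ u ≔ 1# ])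
      ψ≈ = trans (D-delete w x̂ 1̂ w∉) (trans (D-absorb x̂ 1̂) (trans (+-congʳ f≈)
        (solve 3 (λ x p r → x :* p :+ r :+ :1 :* p := (:1 :+ x) :* p :+ r) refl _ _ _)))
    -- An old vertex is compared with itself; the extra term is a determinant with `u` and that
    -- vertex both deleted, up to a factor zero or one.
    ψ-bound (leaf {u = u} pend G) (there {xs = vs} v∈) = ≼-respʳ (sym (Pendant.ψ-pendant pend v∈))
      (≼-trans (≼-* Pos-1+x (ψ-bound G v∈)) (≼-+Pos (Pos-* Pos-x (Pos-*
        (Pos-≔ Pos-1̂ _ Pos-0 u)
        (Pos-D G (Pos-≔ (Pos-≔ Pos-x̂ _ Pos-1) u Pos-1) (Pos-≔ (Pos-≔ Pos-1̂ _ Pos-0) u Pos-0))))))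
    ψ-bound (perm p G) v∈ = ≼-respʳ (D-perm _ _ p) (ψ-bound G (∈-resp-↭ (↭-sym p) v∈))

    f-bound : OddUnicyclic m vs → star m ≼ f vs
    f-bound (cycle {q = q} cyc _) = ≼-respʳ (sym (f-cycle cyc)) (star≼oddCycle (length q))
    f-bound (leaf pend G) = ≼-respʳ (sym (Pendant.f-pendant pend))
      (≼-+ (≼-* Pos-1+x (f-bound G)) (≼-* Pos-x (ψ-bound G (here ≡.refl))))
    f-bound (perm p G) = ≼-respʳ (D-perm _ _ p) (f-bound G)

    -- The centre stays outside the list because every leaf is attached to it. This makes the bounds
    -- sharp: in `ψ-pendant` the extra term carries the weight of the deleted centre, which is zero.
    data Star (u : A) : ℕ → List A → Set where
      triangle : InducedCycle u k [] l → Star u 0 (k ∷ l ∷ [])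
      leaf     : Pendant w u vs → Star u m vs → Star u (suc m) (w ∷ vs)

    ψ-star : Star u m vs → ψ u (u ∷ vs) ≈ starRoot m
    ψ-star (triangle cyc) = ψ-cycle cyc
    ψ-star {u} (leaf {vs = vs} pend S) = trans (D-perm _ _ (swap u _ (Perm.refl {xs = vs})))
      (trans (Pendant.ψ-pendant pend (here ≡.refl)) (trans
        (+-cong (*-congˡ (ψ-star S)) (*-congˡ (trans (*-congʳ (reflexive (≔-here 1̂ u))) (zeroˡ _))))
        (trans (+-congˡ (zeroʳ x)) (+-identityʳ _))))

    f-star : Star u m vs → f (u ∷ vs) ≈ star m
    f-star (triangle cyc) = f-cycle cyc
    f-star {u} (leaf {vs = vs} pend S) = trans (D-perm _ _ (swap u _ (Perm.refl {xs = vs})))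
      (trans (Pendant.f-pendant pend) (+-cong (*-congˡ (f-star S)) (*-congˡ (ψ-star S))))

-- The commutative ring of integer polynomials.

open ≡ using (refl; cong; cong₂; sym; trans; subst; module ≡-Reasoning)
open +-*-Solver using (solve; _:=_; _:+_; _:*_; con)

infix 4 _≈ᴾ_
-- Trailing zeros give one polynomial many coefficient lists, so equality is taken coefficientwise.
record _≈ᴾ_ (p q : Poly) : Set where
  constructor coeffs
  field at : ∀ k → coeff p k ≡ coeff q k
open _≈ᴾ_

private variable
  p p′ q q′ r : Poly

≈ᴾ-refl : p ≈ᴾ p
≈ᴾ-refl = coeffs λ _ → refl

≈ᴾ-sym : p ≈ᴾ q → q ≈ᴾ p
≈ᴾ-sym e = coeffs λ k → sym (at e k)

≈ᴾ-trans : p ≈ᴾ q → q ≈ᴾ r → p ≈ᴾ r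
≈ᴾ-trans e f = coeffs λ k → trans (at e k) (at f k)

coeff-⊕ : ∀ p q k → coeff (p ⊕ q) k ≡ coeff p k ℤ.+ coeff q k
coeff-⊕ []      q       k       = sym (ℤ.+-identityˡ _)
coeff-⊕ (a ∷ p) []      k       = sym (ℤ.+-identityʳ _)
coeff-⊕ (a ∷ p) (b ∷ q) zero    = refl
coeff-⊕ (a ∷ p) (b ∷ q) (suc k) = coeff-⊕ p q k

coeff-scale : ∀ a p k → coeff (scale a p) k ≡ a ℤ.* coeff p k
coeff-scale a []      k       = sym (ℤ.*-zeroʳ a)
coeff-scale a (b ∷ p) zero    = refl
coeff-scale a (b ∷ p) (suc k) = coeff-scale a p k

coeff-⊗-zero : ∀ a p q → coeff ((a ∷ p) ⊗ q) 0 ≡ a ℤ.* coeff q 0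
coeff-⊗-zero a p q = trans (coeff-⊕ (scale a q) _ 0)
  (trans (ℤ.+-identityʳ _) (coeff-scale a q 0))

coeff-⊗-suc : ∀ a p q k → coeff ((a ∷ p) ⊗ q) (suc k) ≡ a ℤ.* coeff q (suc k) ℤ.+ coeff (p ⊗ q) k
coeff-⊗-suc a p q k = trans (coeff-⊕ (scale a q) _ (suc k)) (cong (ℤ._+ _) (coeff-scale a q (suc k)))

⊕-cong : p ≈ᴾ p′ → q ≈ᴾ q′ → p ⊕ q ≈ᴾ p′ ⊕ q′
⊕-cong {p} {p′} {q} {q′} e f = coeffs λ k →
  trans (coeff-⊕ p q k) (trans (cong₂ ℤ._+_ (at e k) (at f k)) (sym (coeff-⊕ p′ q′ k)))

scale-cong : ∀ a → p ≈ᴾ q → scale a p ≈ᴾ scale a q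
scale-cong {p} {q} a e = coeffs λ k →
  trans (coeff-scale a p k) (trans (cong (a ℤ.*_) (at e k)) (sym (coeff-scale a q k)))

shift-cong : p ≈ᴾ q → + 0 ∷ p ≈ᴾ + 0 ∷ q
shift-cong e = coeffs λ { zero → refl ; (suc k) → at e k }

⊕-comm : ∀ p q → p ⊕ q ≈ᴾ q ⊕ p
⊕-comm p q = coeffs λ k → trans (coeff-⊕ p q k) (trans (ℤ.+-comm (coeff p k) (coeff q k)) (sym (coeff-⊕ q p k)))

⊕-assoc : ∀ p q r → (p ⊕ q) ⊕ r ≈ᴾ p ⊕ (q ⊕ r)
⊕-assoc p q r = coeffs λ k → begin
  coeff ((p ⊕ q) ⊕ r) k                       ≡⟨ coeff-⊕ (p ⊕ q) r k ⟩
  coeff (p ⊕ q) k ℤ.+ coeff r k               ≡⟨ cong (ℤ._+ coeff r k) (coeff-⊕ p q k) ⟩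
  coeff p k ℤ.+ coeff q k ℤ.+ coeff r k       ≡⟨ ℤ.+-assoc (coeff p k) (coeff q k) (coeff r k) ⟩
  coeff p k ℤ.+ (coeff q k ℤ.+ coeff r k)     ≡⟨ cong (λ c → coeff p k ℤ.+ c) (coeff-⊕ q r k) ⟨
  coeff p k ℤ.+ coeff (q ⊕ r) k               ≡⟨ coeff-⊕ p (q ⊕ r) k ⟨
  coeff (p ⊕ (q ⊕ r)) k                       ∎
  where open ≡-Reasoning

⊕-inverse : ∀ p → scale -1ℤ p ⊕ p ≈ᴾ []
⊕-inverse p = coeffs λ k → trans (coeff-⊕ (scale -1ℤ p) p k)
  (trans (cong (ℤ._+ coeff p k) (coeff-scale -1ℤ p k))
  (solve 1 (λ a → con -1ℤ :* a :+ a := con 0ℤ) refl (coeff p k)))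

⊗-congˡ : ∀ p → q ≈ᴾ q′ → p ⊗ q ≈ᴾ p ⊗ q′
⊗-congˡ []      e = ≈ᴾ-refl
⊗-congˡ (a ∷ p) e = ⊕-cong (scale-cong a e) (shift-cong (⊗-congˡ p e))

⊗-zeroʳ : ∀ p → p ⊗ [] ≈ᴾ []
⊗-zeroʳ []      = ≈ᴾ-refl
⊗-zeroʳ (a ∷ p) = coeffs λ { zero → refl ; (suc k) → at (⊗-zeroʳ p) k }

-- The defining recursion of `_⊗_` transferred to the right factor. Commutativity follows from it,
-- and the laws on one side then yield those on the other.
⊗-∷ : ∀ p b q → p ⊗ (b ∷ q) ≈ᴾ scale b p ⊕ (+ 0 ∷ (p ⊗ q))
⊗-∷ []      b q = coeffs λ { zero → refl ; (suc k) → refl }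
⊗-∷ (a ∷ p) b q = coeffs λ { zero → cong (ℤ._+ + 0) (ℤ.*-comm a b) ; (suc k) → next k }
  where
  open ≡-Reasoning
  next : ∀ k → coeff (scale a q ⊕ (p ⊗ (b ∷ q))) k ≡ coeff (scale b p ⊕ ((a ∷ p) ⊗ q)) k
  next k = begin
    coeff (scale a q ⊕ (p ⊗ (b ∷ q))) k
      ≡⟨ at (⊕-cong (≈ᴾ-refl {scale a q}) (⊗-∷ p b q)) k ⟩
    coeff (scale a q ⊕ (scale b p ⊕ (+ 0 ∷ (p ⊗ q)))) k
      ≡⟨ at (⊕-assoc (scale a q) (scale b p) _) k ⟨
    coeff ((scale a q ⊕ scale b p) ⊕ (+ 0 ∷ (p ⊗ q))) k
      ≡⟨ at (⊕-cong (⊕-comm (scale a q) (scale b p)) (≈ᴾ-refl {+ 0 ∷ (p ⊗ q)})) k ⟩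
    coeff ((scale b p ⊕ scale a q) ⊕ (+ 0 ∷ (p ⊗ q))) k
      ≡⟨ at (⊕-assoc (scale b p) (scale a q) _) k ⟩
    coeff (scale b p ⊕ ((a ∷ p) ⊗ q)) k ∎

⊗-comm : ∀ p q → p ⊗ q ≈ᴾ q ⊗ p
⊗-comm []      q = ≈ᴾ-sym (⊗-zeroʳ q)
⊗-comm (a ∷ p) q = ≈ᴾ-trans (⊕-cong ≈ᴾ-refl (shift-cong (⊗-comm p q))) (≈ᴾ-sym (⊗-∷ q a p))

⊗-cong : p ≈ᴾ p′ → q ≈ᴾ q′ → p ⊗ q ≈ᴾ p′ ⊗ q′
⊗-cong {p} {p′} {q} {q′} e f = ≈ᴾ-trans (⊗-congˡ p f)
  (≈ᴾ-trans (⊗-comm p q′) (≈ᴾ-trans (⊗-congˡ q′ e) (⊗-comm q′ p′)))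

⊗-distribˡ : ∀ p q r → p ⊗ (q ⊕ r) ≈ᴾ (p ⊗ q) ⊕ (p ⊗ r)
⊗-distribˡ []      q r = ≈ᴾ-refl
⊗-distribˡ (a ∷ p) q r = coeffs λ
  { zero    → begin
      coeff ((a ∷ p) ⊗ (q ⊕ r)) 0                          ≡⟨ coeff-⊗-zero a p (q ⊕ r) ⟩
      a ℤ.* coeff (q ⊕ r) 0                                ≡⟨ cong (a ℤ.*_) (coeff-⊕ q r 0) ⟩
      a ℤ.* (coeff q 0 ℤ.+ coeff r 0)                      ≡⟨ ℤ.*-distribˡ-+ a (coeff q 0) (coeff r 0) ⟩
      a ℤ.* coeff q 0 ℤ.+ a ℤ.* coeff r 0                  ≡⟨ cong₂ ℤ._+_ (coeff-⊗-zero a p q) (coeff-⊗-zero a p r) ⟨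
      coeff ((a ∷ p) ⊗ q) 0 ℤ.+ coeff ((a ∷ p) ⊗ r) 0      ≡⟨ coeff-⊕ ((a ∷ p) ⊗ q) ((a ∷ p) ⊗ r) 0 ⟨
      coeff (((a ∷ p) ⊗ q) ⊕ ((a ∷ p) ⊗ r)) 0              ∎
  ; (suc k) → begin
      coeff ((a ∷ p) ⊗ (q ⊕ r)) (suc k)
        ≡⟨ coeff-⊗-suc a p (q ⊕ r) k ⟩
      a ℤ.* coeff (q ⊕ r) (suc k) ℤ.+ coeff (p ⊗ (q ⊕ r)) k
        ≡⟨ cong₂ (λ s t → a ℤ.* s ℤ.+ t) (coeff-⊕ q r (suc k))
             (trans (at (⊗-distribˡ p q r) k) (coeff-⊕ (p ⊗ q) (p ⊗ r) k)) ⟩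
      a ℤ.* (coeff q (suc k) ℤ.+ coeff r (suc k)) ℤ.+ (coeff (p ⊗ q) k ℤ.+ coeff (p ⊗ r) k)
        ≡⟨ solve 5 (λ a s t u v → a :* (s :+ t) :+ (u :+ v) := (a :* s :+ u) :+ (a :* t :+ v)) refl
             a (coeff q (suc k)) (coeff r (suc k)) _ _ ⟩
      (a ℤ.* coeff q (suc k) ℤ.+ coeff (p ⊗ q) k) ℤ.+ (a ℤ.* coeff r (suc k) ℤ.+ coeff (p ⊗ r) k)
        ≡⟨ cong₂ ℤ._+_ (coeff-⊗-suc a p q k) (coeff-⊗-suc a p r k) ⟨
      coeff ((a ∷ p) ⊗ q) (suc k) ℤ.+ coeff ((a ∷ p) ⊗ r) (suc k)
        ≡⟨ coeff-⊕ ((a ∷ p) ⊗ q) ((a ∷ p) ⊗ r) (suc k) ⟨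
      coeff (((a ∷ p) ⊗ q) ⊕ ((a ∷ p) ⊗ r)) (suc k) ∎
  }
  where open ≡-Reasoning

⊗-distribʳ : ∀ p q r → (q ⊕ r) ⊗ p ≈ᴾ (q ⊗ p) ⊕ (r ⊗ p)
⊗-distribʳ p q r = ≈ᴾ-trans (⊗-comm (q ⊕ r) p)
  (≈ᴾ-trans (⊗-distribˡ p q r) (⊕-cong (⊗-comm p q) (⊗-comm p r)))

scale-⊗ : ∀ a p q → scale a p ⊗ q ≈ᴾ scale a (p ⊗ q)
scale-⊗ a []      q = ≈ᴾ-refl
scale-⊗ a (b ∷ p) q = coeffs λ
  { zero    → trans (coeff-⊗-zero (a ℤ.* b) (scale a p) q) (trans (ℤ.*-assoc a b (coeff q 0))
      (sym (trans (coeff-scale a ((b ∷ p) ⊗ q) 0) (cong (a ℤ.*_) (coeff-⊗-zero b p q)))))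
  ; (suc k) → begin
      coeff (scale a (b ∷ p) ⊗ q) (suc k)
        ≡⟨ coeff-⊗-suc (a ℤ.* b) (scale a p) q k ⟩
      a ℤ.* b ℤ.* coeff q (suc k) ℤ.+ coeff (scale a p ⊗ q) k
        ≡⟨ cong (λ c → a ℤ.* b ℤ.* coeff q (suc k) ℤ.+ c) (trans (at (scale-⊗ a p q) k) (coeff-scale a (p ⊗ q) k)) ⟩
      a ℤ.* b ℤ.* coeff q (suc k) ℤ.+ a ℤ.* coeff (p ⊗ q) k
        ≡⟨ solve 4 (λ a b s t → a :* b :* s :+ a :* t := a :* (b :* s :+ t)) refl a b (coeff q (suc k)) _ ⟩
      a ℤ.* (b ℤ.* coeff q (suc k) ℤ.+ coeff (p ⊗ q) k)
        ≡⟨ cong (a ℤ.*_) (coeff-⊗-suc b p q k) ⟨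
      a ℤ.* coeff ((b ∷ p) ⊗ q) (suc k)
        ≡⟨ coeff-scale a ((b ∷ p) ⊗ q) (suc k) ⟨
      coeff (scale a ((b ∷ p) ⊗ q)) (suc k) ∎
  }
  where open ≡-Reasoning

scale-zero : ∀ p → scale (+ 0) p ≈ᴾ []
scale-zero p = coeffs λ k → trans (coeff-scale (+ 0) p k) (ℤ.*-zeroˡ (coeff p k))

shift-⊗ : ∀ p q → (+ 0 ∷ p) ⊗ q ≈ᴾ + 0 ∷ (p ⊗ q)
shift-⊗ p q = ⊕-cong (scale-zero q) ≈ᴾ-refl

⊗-assoc : ∀ p q r → (p ⊗ q) ⊗ r ≈ᴾ p ⊗ (q ⊗ r)
⊗-assoc []      q r = ≈ᴾ-refl
⊗-assoc (a ∷ p) q r = ≈ᴾ-trans (⊗-distribʳ r (scale a q) (+ 0 ∷ (p ⊗ q)))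
  (⊕-cong (scale-⊗ a q r) (≈ᴾ-trans (shift-⊗ (p ⊗ q) r) (shift-cong (⊗-assoc p q r))))

⊗-identityˡ : ∀ p → [ 1ℤ ] ⊗ p ≈ᴾ p
⊗-identityˡ p = coeffs λ
  { zero    → trans (coeff-⊗-zero 1ℤ [] p) (ℤ.*-identityˡ (coeff p 0))
  ; (suc k) → trans (coeff-⊗-suc 1ℤ [] p k) (trans (ℤ.+-identityʳ _) (ℤ.*-identityˡ (coeff p (suc k))))
  }

polyRing : CommutativeRing _ _
polyRing = record
  { Carrier = Poly
  ; _≈_     = _≈ᴾ_
  ; _+_     = _⊕_
  ; _*_     = _⊗_
  ; -_      = scale -1ℤ
  ; 0#      = []
  ; 1#      = [ 1ℤ ]
  ; isCommutativeRing = record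
    { isRing = record
      { +-isAbelianGroup = record
        { isGroup = record
          { isMonoid = record
            { isSemigroup = record
              { isMagma = record
                { isEquivalence = record { refl = ≈ᴾ-refl ; sym = ≈ᴾ-sym ; trans = ≈ᴾ-trans }
                ; ∙-cong = ⊕-cong
                }
              ; assoc = ⊕-assoc
              }
            ; identity = (λ _ → ≈ᴾ-refl) , (λ p → ⊕-comm p [])
            }
          ; inverse = ⊕-inverse , (λ p → ≈ᴾ-trans (⊕-comm p _) (⊕-inverse p))
          ; ⁻¹-cong = scale-cong -1ℤ
          }
        ; comm = ⊕-comm
        }
      ; *-cong     = ⊗-cong
      ; *-assoc    = ⊗-assoc
      ; *-identity = ⊗-identityˡ , (λ p → ≈ᴾ-trans (⊗-comm p _) (⊗-identityˡ p))
      ; distrib    = ⊗-distribˡ , ⊗-distribʳ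
      }
    ; *-comm = ⊗-comm
    }
  }

-- Polynomials with alternating signs as a positive cone.

sign-suc : ∀ k → sign (suc k) ≡ ℤ.- sign k
sign-suc zero          = refl
sign-suc (suc zero)    = refl
sign-suc (suc (suc k)) = sign-suc k

sign-+ : ∀ m n → sign (m ℕ.+ n) ≡ sign m ℤ.* sign n
sign-+ zero    n = sym (ℤ.*-identityˡ (sign n))
sign-+ (suc m) n = begin
  sign (suc (m ℕ.+ n))            ≡⟨ sign-suc (m ℕ.+ n) ⟩
  ℤ.- sign (m ℕ.+ n)              ≡⟨ cong ℤ.-_ (sign-+ m n) ⟩
  ℤ.- (sign m ℤ.* sign n)         ≡⟨ ℤ.neg-distribˡ-* (sign m) (sign n) ⟩
  (ℤ.- sign m) ℤ.* sign n         ≡⟨ cong (ℤ._* sign n) (sign-suc m) ⟨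
  sign (suc m) ℤ.* sign n         ∎
  where open ≡-Reasoning

sign-square : ∀ m → sign m ℤ.* sign m ≡ 1ℤ
sign-square zero          = refl
sign-square (suc zero)    = refl
sign-square (suc (suc m)) = sign-square m

-- (-1)^e p(-X) has nonnegative coefficients.
record Alternating (e : ℕ) (p : Poly) : Set where
  constructor alternating
  field nonneg : ∀ k → 0ℤ ℤ.≤ sign (e ℕ.+ k) ℤ.* coeff p k
open Alternating

nonneg-* : ∀ {i j} → 0ℤ ℤ.≤ i → 0ℤ ℤ.≤ j → 0ℤ ℤ.≤ i ℤ.* j
nonneg-* {+ m} {+ n} _ _ = ≡.subst (0ℤ ℤ.≤_) (ℤ.pos-* m n) (ℤ.+≤+ ℕ.z≤n)

Alternating-[] : ∀ {e} → Alternating e []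
Alternating-[] {e} = alternating λ k → ℤ.≤-reflexive (sym (ℤ.*-zeroʳ (sign (e ℕ.+ k))))

-- Dropping the constant term changes the parity of all positions; the offset `e` records this, so
-- that products can be treated by recursion on the coefficient list.
Alternating-tail : ∀ {e a p} → Alternating e (a ∷ p) → Alternating (suc e) p
Alternating-tail {e} {a} {p} h = alternating λ k →
  ≡.subst (λ n → 0ℤ ℤ.≤ sign n ℤ.* coeff p k) (ℕ.+-suc e k) (nonneg h (suc k))

Alternating-shift : ∀ {e p} → Alternating (suc e) p → Alternating e (+ 0 ∷ p)
Alternating-shift {e} {p} h = alternating λ
  { zero    → ℤ.≤-reflexive (sym (ℤ.*-zeroʳ (sign (e ℕ.+ 0))))
  ; (suc k) → ≡.subst (λ n → 0ℤ ℤ.≤ sign n ℤ.* coeff p k) (sym (ℕ.+-suc e k)) (nonneg h k)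
  }

Alternating-≈ : ∀ {e} → p ≈ᴾ q → Alternating e p → Alternating e q
Alternating-≈ {e = e} eq h = alternating λ k →
  ≡.subst (λ c → 0ℤ ℤ.≤ sign (e ℕ.+ k) ℤ.* c) (at eq k) (nonneg h k)

Alternating-⊕ : ∀ {e} → Alternating e p → Alternating e q → Alternating e (p ⊕ q)
Alternating-⊕ {p} {q} {e} h h′ = alternating λ k → ≡.subst (0ℤ ℤ.≤_)
  (trans (sym (ℤ.*-distribˡ-+ (sign (e ℕ.+ k)) (coeff p k) (coeff q k)))
         (cong (sign (e ℕ.+ k) ℤ.*_) (sym (coeff-⊕ p q k))))
  (ℤ.+-mono-≤ (nonneg h k) (nonneg h′ k))

Alternating-scale : ∀ {e d a} → 0ℤ ℤ.≤ sign e ℤ.* a → Alternating d p → Alternating (e ℕ.+ d) (scale a p)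
Alternating-scale {p} {e} {d} {a} ha h = alternating λ k → ≡.subst (0ℤ ℤ.≤_) (eq k) (nonneg-* ha (nonneg h k))
  where
  open ≡-Reasoning
  eq : ∀ k → (sign e ℤ.* a) ℤ.* (sign (d ℕ.+ k) ℤ.* coeff p k) ≡ sign (e ℕ.+ d ℕ.+ k) ℤ.* coeff (scale a p) k
  eq k = begin
    (sign e ℤ.* a) ℤ.* (sign (d ℕ.+ k) ℤ.* coeff p k)
      ≡⟨ solve 4 (λ s a t c → (s :* a) :* (t :* c) := (s :* t) :* (a :* c)) refl (sign e) a (sign (d ℕ.+ k)) (coeff p k) ⟩
    (sign e ℤ.* sign (d ℕ.+ k)) ℤ.* (a ℤ.* coeff p k)
      ≡⟨ cong₂ ℤ._*_ (sign-+ e (d ℕ.+ k)) (coeff-scale a p k) ⟨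
    sign (e ℕ.+ (d ℕ.+ k)) ℤ.* coeff (scale a p) k
      ≡⟨ cong (λ n → sign n ℤ.* coeff (scale a p) k) (ℕ.+-assoc e d k) ⟨
    sign (e ℕ.+ d ℕ.+ k) ℤ.* coeff (scale a p) k ∎

Alternating-⊗ : ∀ {e d} → Alternating e p → Alternating d q → Alternating (e ℕ.+ d) (p ⊗ q)
Alternating-⊗ {[]}            h h′ = Alternating-[]
Alternating-⊗ {a ∷ p} {e = e} h h′ = Alternating-⊕
  (Alternating-scale (≡.subst (λ n → 0ℤ ℤ.≤ sign n ℤ.* a) (ℕ.+-identityʳ e) (nonneg h 0)) h′)
  (Alternating-shift (Alternating-⊗ (Alternating-tail h) h′))

alternatingCone : PositiveCone polyRing
alternatingCone = record
  { Pos      = Alternating 0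
  ; Pos-resp = Alternating-≈
  ; Pos-0    = Alternating-[]
  ; Pos-1    = alternating λ { zero → ℤ.+≤+ ℕ.z≤n ; (suc k) → nonneg (Alternating-[] {1}) k }
  ; Pos-+    = Alternating-⊕
  ; Pos-*    = Alternating-⊗
  }

-- The value given to `x`. With it `xI + Q` is `-(XI - Q)`, so f is the characteristic polynomial up
-- to the sign (-1)^n, and nonnegative coefficients in `x` become alternating ones in X.
-X : Poly
-X = 0ℤ ∷ -1ℤ ∷ []

Alternating-X : Alternating 0 -X
Alternating-X = alternating λ
  { zero → ℤ.+≤+ ℕ.z≤n ; (suc zero) → ℤ.+≤+ ℕ.z≤n ; (suc (suc k)) → nonneg (Alternating-[] {2}) k }

-- The characteristic polynomial as a list determinant.

scale-sign-suc : ∀ k p → scale (sign (suc k)) p ≈ᴾ scale -1ℤ (scale (sign k) p)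
scale-sign-suc k p = coeffs λ i → begin
  coeff (scale (sign (suc k)) p) i             ≡⟨ coeff-scale (sign (suc k)) p i ⟩
  sign (suc k) ℤ.* coeff p i                   ≡⟨ cong (ℤ._* coeff p i) (trans (sign-suc k) (sym (ℤ.-1*i≡-i (sign k)))) ⟩
  -1ℤ ℤ.* sign k ℤ.* coeff p i                 ≡⟨ ℤ.*-assoc -1ℤ (sign k) (coeff p i) ⟩
  -1ℤ ℤ.* (sign k ℤ.* coeff p i)               ≡⟨ cong (-1ℤ ℤ.*_) (coeff-scale (sign k) p i) ⟨
  -1ℤ ℤ.* coeff (scale (sign k) p) i           ≡⟨ coeff-scale -1ℤ (scale (sign k) p) i ⟨
  coeff (scale -1ℤ (scale (sign k) p)) i       ∎
  where open ≡-Reasoning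

scale-⊕ : ∀ a p q → scale a (p ⊕ q) ≈ᴾ scale a p ⊕ scale a q
scale-⊕ a p q = coeffs λ i → begin
  coeff (scale a (p ⊕ q)) i                          ≡⟨ coeff-scale a (p ⊕ q) i ⟩
  a ℤ.* coeff (p ⊕ q) i                              ≡⟨ cong (a ℤ.*_) (coeff-⊕ p q i) ⟩
  a ℤ.* (coeff p i ℤ.+ coeff q i)                    ≡⟨ ℤ.*-distribˡ-+ a (coeff p i) (coeff q i) ⟩
  a ℤ.* coeff p i ℤ.+ a ℤ.* coeff q i                ≡⟨ cong₂ ℤ._+_ (coeff-scale a p i) (coeff-scale a q i) ⟨
  coeff (scale a p) i ℤ.+ coeff (scale a q) i        ≡⟨ coeff-⊕ (scale a p) (scale a q) i ⟨
  coeff (scale a p ⊕ scale a q) i                    ∎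
  where open ≡-Reasoning

scale-one : ∀ p → scale 1ℤ p ≈ᴾ p
scale-one p = coeffs λ i → trans (coeff-scale 1ℤ p i) (ℤ.*-identityˡ (coeff p i))

sumFin-neg : ∀ {n} (e : Fin n → ℕ) (X : Fin n → Poly) →
  sumFin _⊕_ [] (λ j → scale (sign (suc (e j))) (X j)) ≈ᴾ scale -1ℤ (sumFin _⊕_ [] (λ j → scale (sign (e j)) (X j)))
sumFin-neg {zero}  e X = ≈ᴾ-refl
sumFin-neg {suc n} e X = ≈ᴾ-trans
  (⊕-cong (scale-sign-suc (e zero) (X zero)) (sumFin-neg (e ∘ suc) (X ∘ suc)))
  (≈ᴾ-sym (scale-⊕ -1ℤ (scale (sign (e zero)) (X zero)) _))

module _ {A : Set} where
  open ListDeterminant polyRing {A}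

  -- Leaving out position j of a tabulated list is composition with `punchIn j`. The parity shift in
  -- the tail, supplied by `sumFin-neg`, is the minus sign in `alt`.
  alt-tabulate : ∀ {n} (F : A → List A → Poly) (X : Fin (suc n) → Poly) (c : Fin (suc n) → A) →
    (∀ j → X j ≈ᴾ F (c j) (tabulate (c ∘ punchIn j))) →
    sumFin _⊕_ [] (λ j → scale (sign (toℕ j)) (X j)) ≈ᴾ alt F (tabulate c)
  alt-tabulate {zero}  F X c h = ⊕-cong (≈ᴾ-trans (scale-one (X zero)) (h zero)) ≈ᴾ-refl
  alt-tabulate {suc n} F X c h = ⊕-cong (≈ᴾ-trans (scale-one (X zero)) (h zero))
    (≈ᴾ-trans (sumFin-neg toℕ (X ∘ suc))
      (scale-cong -1ℤ (alt-tabulate (λ d es → F d (c zero ∷ es)) (X ∘ suc) (c ∘ suc) (λ j → h (suc j)))))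

  det-tabulate : ∀ {n} (K : A → A → Poly) (M : Fin n → Fin n → Poly) (r c : Fin n → A) →
    (∀ i j → M i j ≈ᴾ K (r i) (c j)) → det M ≈ᴾ ldet K (tabulate r) (tabulate c)
  det-tabulate {zero}  K M r c h = ≈ᴾ-refl
  det-tabulate {suc n} K M r c h = alt-tabulate (λ e es → K (r zero) e ⊗ ldet K (tabulate (r ∘ suc)) es) _ c λ j →
    ⊗-cong (h zero j) (det-tabulate K _ (r ∘ suc) (c ∘ punchIn j) λ i k → h (suc i) (punchIn j k))

  coeff-signed : ∀ n p k → coeff (signed n p) k ≡ sign n ℤ.* coeff p k
  coeff-signed zero    p k = sym (ℤ.*-identityˡ _)
  coeff-signed (suc n) p k = begin
    coeff (scale -1ℤ (signed n p)) k      ≡⟨ coeff-scale -1ℤ (signed n p) k ⟩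
    -1ℤ ℤ.* coeff (signed n p) k          ≡⟨ cong (-1ℤ ℤ.*_) (coeff-signed n p k) ⟩
    -1ℤ ℤ.* (sign n ℤ.* coeff p k)        ≡⟨ ℤ.*-assoc -1ℤ (sign n) (coeff p k) ⟨
    -1ℤ ℤ.* sign n ℤ.* coeff p k          ≡⟨ cong (ℤ._* coeff p k) (trans (ℤ.-1*i≡-i (sign n)) (sym (sign-suc n))) ⟩
    sign (suc n) ℤ.* coeff p k            ∎
    where open ≡-Reasoning

open Bounds polyRing alternatingCone -X Alternating-X

module Relabelling {A : Set} (_≟_ : DecidableEquality A)
  (adjᴬ : A → A → Bool) (adj-sym : ∀ u v → adjᴬ u v ≡ adjᴬ v u) (adj-irrefl : ∀ v → adjᴬ v v ≡ false)
  {n} (H : SimpleGraph n) (r : Fin n → A)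
  (r-adj : ∀ i j → adjᴬ (r i) (r j) ≡ adj H i j) (r-≟ : ∀ i j → does (r i ≟ r j) ≡ (i == j)) where

  open WeightedGraph polyRing _≟_ adjᴬ adj-sym adj-irrefl
  open ListDeterminant polyRing {A}
  open Graph _≟_ adjᴬ adj-sym adj-irrefl using (x̂; 1̂; f)

  deg-tabulate : ∀ {m} (c : Fin m → A) (b : Fin m → Bool) y → (∀ j → adjᴬ y (c j) ≡ b j) →
    deg (tabulate c) y ≈ᴾ [ + sumFin ℕ._+_ 0 (λ j → b2ℕ (b j)) ]
  deg-tabulate {zero}  c b y h = coeffs λ { zero → refl ; (suc k) → refl }
  deg-tabulate {suc m} c b y h = coeffs λ k → begin
    coeff (ι (adjᴬ y (c zero)) ⊕ d) k             ≡⟨ coeff-⊕ (ι (adjᴬ y (c zero))) d k ⟩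
    coeff (ι (adjᴬ y (c zero))) k ℤ.+ coeff d k   ≡⟨ cong₂ (λ z t → coeff (ι z) k ℤ.+ t) (h zero)
                                                       (at (deg-tabulate (c ∘ suc) (b ∘ suc) y (h ∘ suc)) k) ⟩
    coeff (ι (b zero)) k ℤ.+ coeff [ + s ] k      ≡⟨ add (b zero) k ⟩
    coeff [ + (b2ℕ (b zero) ℕ.+ s) ] k            ∎
    where
    open ≡-Reasoning
    d = deg (tabulate (c ∘ suc)) y
    s = sumFin ℕ._+_ 0 (λ j → b2ℕ (b (suc j)))
    add : ∀ z k → coeff (ι z) k ℤ.+ coeff [ + s ] k ≡ coeff [ + (b2ℕ z ℕ.+ s) ] k
    add true  zero    = refl
    add true  (suc k) = refl
    add false zero    = refl
    add false (suc k) = refl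

  entries : ∀ i j →
    (if i == j then (ℤ.- Q H i j) ∷ (+ 1 ∷ []) else (ℤ.- Q H i j) ∷ []) ≈ᴾ
    scale -1ℤ (entry (tabulate r) x̂ 1̂ (r i) (r j))
  entries i j rewrite r-≟ i j with i == j
  ... | false rewrite r-adj i j = off (adj H i j)
    where
    off : ∀ b → [ ℤ.- + b2ℕ b ] ≈ᴾ scale -1ℤ ([ 1ℤ ] ⊗ ι b)
    off true  = coeffs λ { zero → refl ; (suc k) → refl }
    off false = coeffs λ { zero → refl ; (suc zero) → refl ; (suc (suc k)) → refl }
  ... | true = ≈ᴾ-sym (≈ᴾ-trans
    (scale-cong -1ℤ (⊕-cong (≈ᴾ-refl { -X })
      (≈ᴾ-trans (⊗-identityˡ (deg (tabulate r) (r i))) (deg-tabulate r (adj H i) (r i) (r-adj i)))))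
    (coeffs λ { zero → trans (cong (λ c → -1ℤ ℤ.* c) (ℤ.+-identityˡ (+ degree H i))) (ℤ.-1*i≡-i (+ degree H i))
              ; (suc zero) → refl ; (suc (suc k)) → refl }))

  charPoly-f : charPolyQ H ≈ᴾ signed n (f (tabulate r))
  charPoly-f = ≈ᴾ-trans (det-tabulate (λ y z → scale -1ℤ (entry (tabulate r) x̂ 1̂ y z)) _ r r entries)
    (≡.subst (λ m → ldet (λ y z → scale -1ℤ (entry (tabulate r) x̂ 1̂ y z)) (tabulate r) (tabulate r) ≈ᴾ signed m (f (tabulate r)))
      (length-tabulate r) (ldet-neg (entry (tabulate r) x̂ 1̂) (tabulate r) (tabulate r)))

  -- Since i and n - i add up to n, the signs (-1)^i from the definition of `φ` and (-1)^n from
  -- `charPoly-f` combine to (-1)^(n - i), the sign with which the cone weighs that coefficient.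
  φ-f : ∀ i → i ℕ.≤ n → φ i H ≡ sign (n ℕ.∸ i) ℤ.* coeff (f (tabulate r)) (n ℕ.∸ i)
  φ-f i i≤n = begin
    sign i ℤ.* coeff (charPolyQ H) k          ≡⟨ cong (sign i ℤ.*_) (trans (at charPoly-f k) (coeff-signed n fr k)) ⟩
    sign i ℤ.* (sign n ℤ.* coeff fr k)        ≡⟨ cong (λ m → sign i ℤ.* (sign m ℤ.* coeff fr k)) (ℕ.m+[n∸m]≡n i≤n) ⟨
    sign i ℤ.* (sign (i ℕ.+ k) ℤ.* coeff fr k) ≡⟨ cong (λ z → sign i ℤ.* (z ℤ.* coeff fr k)) (sign-+ i k) ⟩
    sign i ℤ.* (sign i ℤ.* sign k ℤ.* coeff fr k)
      ≡⟨ solve 3 (λ s t c → s :* (s :* t :* c) := (s :* s) :* (t :* c)) refl (sign i) (sign k) (coeff fr k) ⟩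
    (sign i ℤ.* sign i) ℤ.* (sign k ℤ.* coeff fr k) ≡⟨ cong (ℤ._* (sign k ℤ.* coeff fr k)) (sign-square i) ⟩
    1ℤ ℤ.* (sign k ℤ.* coeff fr k)            ≡⟨ ℤ.*-identityˡ _ ⟩
    sign k ℤ.* coeff fr k                     ∎
    where
    open ≡-Reasoning
    k  = n ℕ.∸ i
    fr = f (tabulate r)

≼⇒≤ : ∀ {p q} → p ≼ q → ∀ k → sign k ℤ.* coeff p k ℤ.≤ sign k ℤ.* coeff q k
≼⇒≤ {p} {q} (d , pd , e) k = begin
  sign k ℤ.* coeff p k                                    ≡⟨ ℤ.+-identityʳ _ ⟨
  sign k ℤ.* coeff p k ℤ.+ 0ℤ                             ≤⟨ ℤ.+-monoʳ-≤ (sign k ℤ.* coeff p k) (Alternating.nonneg pd k) ⟩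
  sign k ℤ.* coeff p k ℤ.+ sign k ℤ.* coeff d k           ≡⟨ ℤ.*-distribˡ-+ (sign k) (coeff p k) (coeff d k) ⟨
  sign k ℤ.* (coeff p k ℤ.+ coeff d k)                    ≡⟨ cong (sign k ℤ.*_) (trans (at e k) (coeff-⊕ p d k)) ⟨
  sign k ℤ.* coeff q k                                    ∎
  where open ℤ.≤-Reasoning

-- Lists without repetitions and counting.

module _ {A : Set} where

  private variable
    x y z : A
    xs ys zs : List A

  Unique-resp-↭ : xs ↭ ys → Unique xs → Unique ys
  Unique-resp-↭ p = PermSetoid.Unique-resp-↭ (≡.setoid A) (↭⇒↭ₛ p)

  unique-head : Unique (x ∷ xs) → x ∉ xs
  unique-head (p ∷ _) = All¬⇒¬Any p

  unique-cons : x ∉ xs → Unique xs → Unique (x ∷ xs)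
  unique-cons x∉ u = ¬Any⇒All¬ _ x∉ ∷ u

  unique-snoc : Unique xs → y ∉ xs → Unique (xs ++ [ y ])
  unique-snoc u y∉ = Unique-resp-↭ (++-comm [ _ ] _) (unique-cons y∉ u)

  ∈-↭ : x ∈ xs → ∃[ ys ] xs ↭ x ∷ ys
  ∈-↭ x∈ with ∈-∃++ x∈
  ... | as , bs , refl = as ++ bs , shift _ as bs

  -- The pigeonhole principle with an explicit remainder; comparing lengths turns it into bounds
  -- and, for equal lengths, into permutations.
  unique-⊆-complement : Unique xs → xs ⊆ ys → ∃[ zs ] xs ++ zs ↭ ys
  unique-⊆-complement {[]}     {ys} u       sub = ys , Perm.refl
  unique-⊆-complement {x ∷ xs} {ys} u@(_ ∷ u′) sub with ∈-↭ (sub (here refl))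
  ... | ys′ , p with unique-⊆-complement u′ sub′
    where
    sub′ : xs ⊆ ys′
    sub′ y∈ with ∈-resp-↭ p (sub (there y∈))
    ... | here refl = contradiction y∈ (unique-head u)
    ... | there y∈′ = y∈′
  ... | zs , q = zs , Perm.trans (prep x q) (↭-sym p)

  unique-⊆-length : Unique xs → xs ⊆ ys → length xs ℕ.≤ length ys
  unique-⊆-length {xs} u sub with unique-⊆-complement u sub
  ... | zs , p = subst (length xs ℕ.≤_) (trans (sym (length-++ xs)) (↭-length p)) (ℕ.m≤m+n _ _)

  unique-⊆-↭ : Unique xs → xs ⊆ ys → length xs ≡ length ys → xs ↭ ys
  unique-⊆-↭ {xs} u sub e with unique-⊆-complement u sub
  ... | []     , p = Perm.trans (↭-sym (++-identityʳ xs)) p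
  ... | z ∷ zs , p = contradiction
    (trans e (trans (sym (↭-length p)) (length-++ xs))) (ℕ.m≢1+m+n (length xs) ∘ λ e′ → trans e′ (ℕ.+-suc _ _))

  zip-∈ : ∀ (xs ys : List A) → (x , y) ∈ zip xs ys → x ∈ xs × y ∈ ys
  zip-∈ (_ ∷ xs) (_ ∷ ys) (here refl) = here refl , here refl
  zip-∈ (_ ∷ xs) (_ ∷ ys) (there p∈)  with zip-∈ xs ys p∈
  ... | x∈ , y∈ = there x∈ , there y∈

  ∈-zip : ∀ (xs ys : List A) → length xs ≡ length ys → x ∈ xs → ∃[ y ] (x , y) ∈ zip xs ys
  ∈-zip (_ ∷ xs) (y ∷ ys) e (here refl) = y , here refl
  ∈-zip (_ ∷ xs) (_ ∷ ys) e (there x∈)  with ∈-zip xs ys (ℕ.suc-injective e) x∈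
  ... | y , p = y , there p

  All-zip-snoc : ∀ {P : A × A → Set} (xs ys : List A) → length xs ≡ length ys → All P (zip xs ys) → P (x , y) →
                 All P (zip (xs ++ [ x ]) (ys ++ [ y ]))
  All-zip-snoc []       []       e ps       p = p ∷ []
  All-zip-snoc (_ ∷ xs) (_ ∷ ys) e (q ∷ ps) p = q ∷ All-zip-snoc xs ys (ℕ.suc-injective e) ps p

  rotate-↭ : ∀ (xs : List A) → rotate xs ↭ xs
  rotate-↭ []       = Perm.refl
  rotate-↭ (x ∷ xs) = ++-comm xs [ x ]

  linked-++ˡ : ∀ {R : A → A → Set} xs → Linked R (xs ++ ys) → Linked R xs
  linked-++ˡ []           l       = []
  linked-++ˡ (x ∷ [])     l       = [-]
  linked-++ˡ (x ∷ y ∷ xs) (r ∷ l) = r ∷ linked-++ˡ (y ∷ xs) l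

-- Building the graph from its cycle by pendent vertices.

module OddUnicyclicGraph {n} (G : SimpleGraph n) (c : List (Fin n)) (uw : UnicyclicWith G c) (odd : Odd (length c)) where

  open Graph Fin._≟_ (adj G) (symm G) (irrefl G)
  open WeightedGraph polyRing Fin._≟_ (adj G) (symm G) (irrefl G)
  open import Data.List.Membership.DecPropositional (Fin._≟_ {n}) using (_∈?_)

  V : Set
  V = Fin n

  private variable
    a b u v w x y z : V
    xs ys zs S : List V
    m : ℕ

  Edge : V × V → Set
  Edge e = Adj G (proj₁ e) (proj₂ e)

  Adj-sym : Adj G u v → Adj G v u
  Adj-sym e = trans (symm G _ _) e

  cycleEdge-∈ : ∀ c → CycleEdge c u v → u ∈ c
  cycleEdge-∈ c (inj₁ uv∈) = proj₁ (zip-∈ c (rotate c) uv∈)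
  cycleEdge-∈ c (inj₂ vu∈) = ∈-resp-↭ (rotate-↭ c) (proj₂ (zip-∈ c (rotate c) vu∈))

  ∈-cycleEdge : ∀ c → u ∈ c → ∃[ v ] CycleEdge c u v
  ∈-cycleEdge c u∈ with ∈-zip c (rotate c) (sym (↭-length (rotate-↭ c))) u∈
  ... | v , e = v , inj₁ e

  -- Each vertex of a cycle lies on one of its edges, so cycles with the same edges have the same
  -- vertices. In this form, together with `cycle-⊇`, the uniqueness of the cycle is used.
  cycle-⊆ : IsCycle G xs → xs ⊆ c
  cycle-⊆ {xs} cyc y∈ with ∈-cycleEdge xs y∈
  ... | v , e = cycleEdge-∈ c (Equivalence.from (proj₂ (proj₂ uw) xs cyc _ v) e)

  cycle-⊇ : IsCycle G xs → c ⊆ xs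
  cycle-⊇ {xs} cyc y∈ with ∈-cycleEdge c y∈
  ... | v , e = cycleEdge-∈ xs (Equivalence.to (proj₂ (proj₂ uw) xs cyc _ v) e)

  data Path : V → List V → V → Set where
    stop : Path a [ a ] a
    _∷_ : Adj G a u → Path u xs b → Path a (a ∷ xs) b

  path-snoc : Path a xs b → Adj G b w → Path a (xs ++ [ w ]) w
  path-snoc stop    e = e ∷ stop
  path-snoc (f ∷ p) e = f ∷ path-snoc p e

  path-closed : Path a (a ∷ xs) b → Adj G b w → All Edge (zip (a ∷ xs) (xs ++ [ w ]))
  path-closed stop           e = e ∷ []
  path-closed (f ∷ stop)     e = f ∷ e ∷ []
  path-closed (f ∷ p@(_ ∷ _)) e = f ∷ path-closed p e

  -- Distinct ends force at least two vertices on the path, so together with `w` the length is at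
  -- least three.
  close : Adj G w a → Adj G b w → Path a xs b → Unique xs → w ∉ xs → a ≢ b → IsCycle G (w ∷ xs)
  close wa bw stop                     uniq w∉ a≢b = contradiction refl a≢b
  close wa bw p@(_∷_ {xs = _ ∷ _} _ _) uniq w∉ a≢b =
    s≤s (s≤s (s≤s z≤n)) , unique-cons w∉ uniq ,
    All.map (λ { {_ , _} e → e }) (wa ∷ path-closed p bw)

  prefix : Linked (Adj G) (a ∷ xs) → Unique (a ∷ xs) → b ∈ a ∷ xs →
           ∃[ ys ] Path a ys b × Unique ys × ys ⊆ a ∷ xs
  prefix l       uniq          (here refl) = _ , stop , [] ∷ [] , λ { (here refl) → here refl }
  prefix {a} (e ∷ l) uniq@(_ ∷ uniq′) (there b∈)  with prefix l uniq′ b∈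
  ... | ys , p , u , sub = a ∷ ys , e ∷ p , unique-cons (unique-head uniq ∘ sub) u ,
    λ { (here refl) → here refl ; (there y∈) → there (sub y∈) }

  ≢true : ∀ {t} → t ≢ true → t ≡ false
  ≢true {true}  h = contradiction refl h
  ≢true {false} h = refl

  -- A chord of the path closes a cycle that misses w.
  induced : w ∈ c → w ∉ xs → Linked (Adj G) (x ∷ xs) → Unique (x ∷ xs) → w ≢ x → InducedPath (x ∷ xs)
  induced w∈ w∉ [-] uniq w≢ = single
  induced {w} {y ∷ zs} {x} w∈ w∉ (e ∷ l) uniq@(_ ∷ uniq′) w≢ = cons e (All.tabulate chordless)
    (induced w∈ (w∉ ∘ there) l uniq′ λ { refl → w∉ (here refl) })
    where
    chordless : z ∈ zs → adj G x z ≡ false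
    chordless {z} z∈ = ≢true λ xz → missed xz (prefix l uniq′ (there z∈))
      where
      missed : Adj G x z → ∃[ ys ] Path y ys z × Unique ys × ys ⊆ y ∷ zs → ⊥
      missed xz (ys , p , u , sub)
        with cycle-⊇ (close e (Adj-sym xz) p u (unique-head uniq ∘ sub)
                        λ { refl → unique-head uniq′ z∈ }) w∈
      ... | here eq  = w≢ eq
      ... | there w∈ = w∉ (sub w∈)

  linked-closed : ∀ a xs → All Edge (zip (a ∷ xs ++ [ z ]) ((xs ++ [ z ]) ++ [ w ])) →
                  Linked (Adj G) (a ∷ xs ++ [ z ]) × Adj G z w
  linked-closed a []       (e ∷ f ∷ []) = e ∷ [-] , f
  linked-closed a (x ∷ xs) (e ∷ es)     with linked-closed x xs es
  ... | l , f = e ∷ l , f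

  edges : ∀ {xs} → IsCycle G xs → All Edge (cycEdges xs)
  edges (_ , _ , es) = All.map (λ { {_ , _} e → e }) es

  isCycle : ∀ {xs} → 3 ℕ.≤ length xs → Unique xs → All Edge (cycEdges xs) → IsCycle G xs
  isCycle 3≤ u es = 3≤ , u , All.map (λ { {_ , _} e → e }) es

  inducedCycle-from : IsCycle G (w ∷ xs) → Odd (length (w ∷ xs)) →
    ∃[ k ] ∃[ q ] ∃[ l ] xs ≡ k ∷ q ++ [ l ] × InducedCycle w k q l
  inducedCycle-from {w} {k ∷ xs} cyc@(s≤s (s≤s _) , uniq , _) o with initLast xs
  inducedCycle-from {w} {k ∷ _}  cyc@(s≤s (s≤s ()) , uniq , _) o | []
  ... | q ∷ʳ′ l = k , q , l , refl , inducedCycle uniq even wk (All.tabulate chordless) (Adj-sym lw)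
      (induced w∈ (unique-head uniq ∘ there) linked uniq′ λ { refl → unique-head uniq (here refl) })
    where
    uniq′ : Unique (k ∷ q ++ [ l ])
    uniq′ = AllPairs.tail uniq
    w∈ : w ∈ c
    w∈ = cycle-⊆ cyc (here refl)
    l∈ : l ∈ c
    l∈ = cycle-⊆ cyc (there (there (∈-++⁺ʳ q (here refl))))
    l∉ : l ∉ k ∷ q
    l∉ = unique-head (Unique-resp-↭ (++-comm (k ∷ q) [ l ]) uniq′)
    even : Odd (suc (length q))
    even with subst (λ j → Odd (suc (suc j))) (trans (length-++ q) (ℕ.+-comm (length q) 1)) o
    ... | odd+2 o′ = o′
    wk : Adj G w k
    wk with edges cyc
    ... | e ∷ _ = e
    closed : Linked (Adj G) (k ∷ q ++ [ l ]) × Adj G l w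
    closed with edges cyc
    ... | _ ∷ es = linked-closed k q es
    linked = proj₁ closed
    lw = proj₂ closed
    -- A chord from `w` to `z` would close a cycle with a path from `k` to `z` inside `k ∷ q`. That
    -- cycle misses `l`, which lies on `c`.
    chordless : z ∈ q → adj G w z ≡ false
    chordless {z} z∈ = ≢true λ wz →
      missed wz (prefix (linked-++ˡ (k ∷ q) linked) (unique-init uniq′) (there z∈))
      where
      unique-init : Unique (k ∷ q ++ [ l ]) → Unique (k ∷ q)
      unique-init u with Unique-resp-↭ (++-comm (k ∷ q) [ l ]) u
      ... | _ ∷ u′ = u′
      missed : Adj G w z → ∃[ ys ] Path k ys z × Unique ys × ys ⊆ k ∷ q → ⊥
      missed wz (ys , p , u , sub)
        with cycle-⊇ (close wk (Adj-sym wz) p u (unique-head uniq ∘ ∈-++⁺ˡ ∘ sub)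
                        λ { refl → unique-head uniq′ (∈-++⁺ˡ z∈) }) l∈
      ... | here refl = unique-head uniq (there (∈-++⁺ʳ q (here refl)))
      ... | there l∈ys = l∉ (sub l∈ys)

  cycle-rotate : IsCycle G (x ∷ xs) → IsCycle G (xs ++ [ x ])
  cycle-rotate {x} {[]} (s≤s () , _)
  cycle-rotate {x} {y ∷ zs} cyc@(3≤ , uniq , _) with edges cyc
  ... | e ∷ es = isCycle (subst (3 ℕ.≤_) (↭-length rot) 3≤) (Unique-resp-↭ rot uniq)
                   (All-zip-snoc (y ∷ zs) (zs ++ [ x ]) (trans (↭-length (++-comm [ y ] zs)) (trans (length-++ zs) (sym (length-++ zs)))) es e)
    where
    rot : x ∷ y ∷ zs ↭ (y ∷ zs) ++ [ x ]
    rot = ++-comm [ x ] (y ∷ zs)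

  cycle-from : ∀ as u bs → IsCycle G (as ++ u ∷ bs) → ∃[ xs ] IsCycle G (u ∷ xs) × u ∷ xs ↭ as ++ u ∷ bs
  cycle-from []       u bs cyc = bs , cyc , Perm.refl
  cycle-from (a ∷ as) u bs cyc
    with cycle-from as u (bs ++ [ a ]) (subst (IsCycle G) (++-assoc as (u ∷ bs) [ a ]) (cycle-rotate cyc))
  ... | xs , cyc′ , p = xs , cyc′ , Perm.trans p (Perm.trans
    (Perm.↭-reflexive (sym (++-assoc as (u ∷ bs) [ a ]))) (++-comm (as ++ u ∷ bs) [ a ]))

  cycle-at : u ∈ c → ∃[ xs ] IsCycle G (u ∷ xs) × u ∷ xs ↭ c
  cycle-at u∈ with ∈-∃++ u∈
  ... | as , bs , eq with cycle-from as _ bs (subst (IsCycle G) eq (proj₁ (proj₂ uw)))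
  ... | xs , cyc , p = xs , cyc , Perm.trans p (Perm.↭-reflexive (sym eq))

  inducedCycle-at : u ∈ c → ∃[ k ] ∃[ q ] ∃[ l ] u ∷ k ∷ q ++ [ l ] ↭ c × InducedCycle u k q l
  inducedCycle-at u∈ with cycle-at u∈
  ... | xs , cyc , p with inducedCycle-from cyc (subst Odd (sym (↭-length p)) odd)
  ... | k , q , l , refl , ic = k , q , l , p , ic

  -- The paths have to stay inside `S`, so that a vertex outside `S` adjacent to both ends can close
  -- them to a cycle.
  ConnectedOn : List V → Set
  ConnectedOn S = ∀ {a b} → a ∈ S → b ∈ S → ∃[ xs ] Path a xs b × Unique xs × xs ⊆ S

  cycle-connected : ConnectedOn c
  cycle-connected a∈ b∈ with cycle-at a∈
  ... | xs , cyc , p with initLast xs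
  ...   | []     = contradiction (proj₁ cyc) λ { (s≤s ()) }
  ...   | q ∷ʳ′ l with prefix (proj₁ (linked-closed _ q (edges cyc))) (proj₁ (proj₂ cyc)) (∈-resp-↭ (↭-sym p) b∈)
  ...     | ys , path , u , sub = ys , path , u , ∈-resp-↭ p ∘ sub

  connected-leaf : ConnectedOn S → w ∉ S → u ∈ S → Adj G w u → ConnectedOn (w ∷ S)
  connected-leaf conn w∉ u∈ wu (here refl) (here refl) = _ , stop , [] ∷ [] , λ { (here refl) → here refl }
  connected-leaf conn w∉ u∈ wu (here refl) (there b∈) with conn u∈ b∈
  ... | xs , p , uniq , sub = _ , wu ∷ p , unique-cons (w∉ ∘ sub) uniq ,
    λ { (here refl) → here refl ; (there y∈) → there (sub y∈) }
  connected-leaf conn w∉ u∈ wu (there a∈) (here refl) with conn a∈ u∈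
  ... | xs , p , uniq , sub = _ , path-snoc p (Adj-sym wu) , unique-snoc uniq (w∉ ∘ sub) ,
    λ y∈ → [ there ∘ sub , (λ { (here refl) → here refl }) ]′ (∈-++⁻ xs y∈)
  connected-leaf conn w∉ u∈ wu (there a∈) (there b∈) with conn a∈ b∈
  ... | xs , p , uniq , sub = xs , p , uniq , there ∘ sub

  record Grown (m : ℕ) (S : List V) : Set where
    field
      structure : OddUnicyclic m S
      unique    : Unique S
      connected : ConnectedOn S
      c⊆S       : c ⊆ S
      size      : length S ≡ 3 ℕ.+ m

  c-nonempty : ∃[ w ] w ∈ c
  c-nonempty = nonempty c (proj₁ (proj₁ (proj₂ uw)))
    where
    nonempty : ∀ (xs : List V) → 3 ℕ.≤ length xs → ∃[ w ] w ∈ xs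
    nonempty (x ∷ _) _ = x , here refl

  root = proj₁ c-nonempty

  size-++ : ∀ (q : List V) l → length (q ++ [ l ]) ≡ suc (length q)
  size-++ q l = trans (length-++ q) (ℕ.+-comm (length q) 1)

  seed : ∃[ m ] Grown m c
  seed with inducedCycle-at (proj₂ c-nonempty)
  ... | k , q , l , p , ic = length q , record
    { structure = perm p (cycle ic λ u∈ → rotated (inducedCycle-at (∈-resp-↭ p u∈)))
    ; unique    = proj₁ (proj₂ (proj₁ (proj₂ uw)))
    ; connected = cycle-connected
    ; c⊆S       = id
    ; size      = trans (sym (↭-length p)) (cong (λ j → suc (suc j)) (size-++ q l))
    }
    where
    C = root ∷ k ∷ q ++ [ l ]
    rotated : ∃[ k′ ] ∃[ q′ ] ∃[ l′ ] u ∷ k′ ∷ q′ ++ [ l′ ] ↭ c × InducedCycle u k′ q′ l′ →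
              ∃[ k′ ] ∃[ q′ ] ∃[ l′ ] u ∷ k′ ∷ q′ ++ [ l′ ] ↭ C × InducedCycle u k′ q′ l′ × length q′ ≡ length q
    rotated (k′ , q′ , l′ , p′ , ic′) = k′ , q′ , l′ , p″ , ic′ ,
      ℕ.suc-injective (trans (sym (size-++ q′ l′))
        (trans (ℕ.suc-injective (ℕ.suc-injective (↭-length p″))) (size-++ q l)))
      where p″ = Perm.trans p′ (↭-sym p)

  crossing : Reach G u v → u ∈ S → v ∉ S → ∃[ a ] ∃[ w ] a ∈ S × w ∉ S × Adj G a w
  crossing here u∈ v∉ = contradiction u∈ v∉
  crossing {S = S} (step {w = w} e r) u∈ v∉ with w ∈? S
  ... | yes w∈ = crossing r w∈ v∉
  ... | no w∉  = _ , w , u∈ , w∉ , e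

  -- A second neighbour of w in S would close a cycle through w ∉ c.
  extend : Grown m S → v ∉ S → ∃[ S′ ] Grown (suc m) S′
  extend {m} {S} g v∉ with crossing (proj₁ uw root _) (Grown.c⊆S g (proj₂ c-nonempty)) v∉
  ... | u , w , u∈ , w∉ , uw′ with ∈-↭ u∈
  ... | vs , p = w ∷ u ∷ vs , record
    { structure = leaf (pendant (unique-cons w∉P uniqP) wu (All.tabulate nonadjacent)) (perm p structure)
    ; unique    = unique-cons w∉P uniqP
    ; connected = connected-leaf (λ a∈ b∈ → moved (connected (back a∈) (back b∈))) w∉P (here refl) wu
    ; c⊆S       = there ∘ ∈-resp-↭ p ∘ c⊆S
    ; size      = cong suc (trans (sym (↭-length p)) size)
    }
    where
    open Grown g
    wu : Adj G w u
    wu = Adj-sym uw′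
    back : ∀ {y} → y ∈ u ∷ vs → y ∈ S
    back = ∈-resp-↭ (↭-sym p)
    w∉P : w ∉ u ∷ vs
    w∉P = w∉ ∘ back
    uniqP : Unique (u ∷ vs)
    uniqP = Unique-resp-↭ p unique
    moved : ∃[ xs ] Path a xs b × Unique xs × xs ⊆ S → ∃[ xs ] Path a xs b × Unique xs × xs ⊆ u ∷ vs
    moved (xs , q , uniq , sub) = xs , q , uniq , ∈-resp-↭ p ∘ sub
    nonadjacent : z ∈ vs → adj G w z ≡ false
    nonadjacent {z} z∈ = ≢true λ wz → absurd wz (connected u∈ (back (there z∈)))
      where
      absurd : Adj G w z → ∃[ xs ] Path u xs z × Unique xs × xs ⊆ S → ⊥
      absurd wz (xs , q , uniq , sub) = w∉ (c⊆S (cycle-⊆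
        (close wu (Adj-sym wz) q uniq (w∉ ∘ sub) λ { refl → unique-head uniqP z∈ }) (here refl)))

  -- The number `d` counts the vertices still missing. Each `extend` lowers it by one, and at zero
  -- `S` must be a permutation of all vertices.
  grow : ∀ d → Grown m S → length S ℕ.+ d ≡ n → ∃[ m′ ] n ≡ 3 ℕ.+ m′ × OddUnicyclic m′ (tabulate id)
  grow {m} {S} zero g e = m , trans (sym full) size , perm
      (unique-⊆-↭ unique (λ {y} _ → ∈-tabulate⁺ y) (trans full (sym (length-tabulate id)))) structure
    where
    open Grown g
    full : length S ≡ n
    full = trans (sym (ℕ.+-identityʳ _)) e
  grow {m} {S} (suc d) g e with Fin.¬∀⟶∃¬ n (_∈ S) (_∈? S) (λ full → ℕ.<⇒≱
      (subst (length S ℕ.<_) e (ℕ.m<m+n _ (s≤s z≤n)))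
      (subst (ℕ._≤ length S) (length-tabulate id) (unique-⊆-length (Unique.allFin⁺ n) λ {y} _ → full y)))
  ... | v , v∉ with extend g v∉
  ... | S′ , g′ = grow d g′ (trans (cong (ℕ._+ d)
        (trans (Grown.size g′) (cong suc (sym (Grown.size g))))) (trans (sym (ℕ.+-suc _ d)) e))

  oddUnicyclic : ∃[ m ] n ≡ 3 ℕ.+ m × OddUnicyclic m (tabulate id)
  oddUnicyclic = grow (n ℕ.∸ length c) (proj₂ seed) (ℕ.m+[n∸m]≡n
    (subst (length c ℕ.≤_) (length-tabulate id)
      (unique-⊆-length (Grown.unique (proj₂ seed)) λ {y} _ → ∈-tabulate⁺ y)))

-- The triangle with pendent edges at one vertex.

module TriangleStar where
  open Graph ℕ._≟_ S3'adj S3'adj-sym S3'adj-irr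
  open WeightedGraph polyRing ℕ._≟_ S3'adj S3'adj-sym S3'adj-irr

  -- Labels in ℕ, unlike labels in `Fin n`, let all sizes share one adjacency function, and the
  -- largest label comes first because `leaf` attaches in front. The order is reconciled with
  -- `tabulate toℕ` by `vertices-↭`.
  others : ℕ → List ℕ
  others zero    = 1 ∷ 2 ∷ []
  others (suc m) = 3 ℕ.+ m ∷ others m

  others-range : ∀ m {y} → y ∈ others m → 0 ℕ.< y × y ℕ.< 3 ℕ.+ m
  others-range zero    (here refl)         = s≤s z≤n , s≤s (s≤s z≤n)
  others-range zero    (there (here refl)) = s≤s z≤n , s≤s (s≤s (s≤s z≤n))
  others-range (suc m) (here refl)         = s≤s z≤n , ℕ.≤-refl
  others-range (suc m) (there y∈) with others-range m y∈
  ... | pos , small = pos , ℕ.m≤n⇒m≤1+n small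

  others-unique : ∀ m → Unique (others m)
  others-unique zero    = ((λ ()) ∷ []) ∷ [] ∷ []
  others-unique (suc m) = unique-cons (λ y∈ → ℕ.<-irrefl refl (proj₂ (others-range m y∈))) (others-unique m)

  vertices-unique : ∀ m → Unique (0 ∷ others m)
  vertices-unique m = unique-cons (λ y∈ → ℕ.<-irrefl refl (proj₁ (others-range m y∈))) (others-unique m)

  far-nonadjacent : ∀ m y → 0 ℕ.< y → S3'adj (3 ℕ.+ m) y ≡ false
  far-nonadjacent m (suc zero)          _ = refl
  far-nonadjacent m (suc (suc zero))    _ = refl
  far-nonadjacent m (suc (suc (suc y))) _ = refl

  isStar : ∀ m → Star 0 m (others m)
  isStar zero    = triangle (inducedCycle (vertices-unique 0) odd1 refl [] refl (cons refl [] single))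
  isStar (suc m) = leaf (pendant
    (unique-cons (λ { (there y∈) → ℕ.<-irrefl refl (proj₂ (others-range m y∈)) }) (vertices-unique m))
    refl (All.tabulate λ y∈ → far-nonadjacent m _ (proj₁ (others-range m y∈)))) (isStar m)

  length-others : ∀ m → length (others m) ≡ 2 ℕ.+ m
  length-others zero    = refl
  length-others (suc m) = cong suc (length-others m)

  vertices-↭ : ∀ {n m} → n ≡ 3 ℕ.+ m → 0 ∷ others m ↭ tabulate {n = n} toℕ
  vertices-↭ {n} {m} n≡ = unique-⊆-↭ (vertices-unique m) inside
    (trans (cong suc (length-others m)) (sym (trans (length-tabulate {n = n} toℕ) n≡)))
    where
    below : ∀ {y} → y ℕ.< 3 ℕ.+ m → y ∈ tabulate {n = n} toℕ
    below y< = subst (_∈ tabulate toℕ) (Fin.toℕ-fromℕ< y<n) (∈-tabulate⁺ (Fin.fromℕ< y<n))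
      where y<n = subst (_ ℕ.<_) (sym n≡) y<
    inside : 0 ∷ others m ⊆ tabulate toℕ
    inside (here refl) = below (s≤s z≤n)
    inside (there y∈)  = below (proj₂ (others-range m y∈))

  f-S3' : ∀ {n m} → n ≡ 3 ℕ.+ m → f (tabulate {n = n} toℕ) ≈ᴾ star m
  f-S3' {n} {m} n≡ = ≈ᴾ-trans (≈ᴾ-sym (D-perm x̂ 1̂ (vertices-↭ {n} {m} n≡))) (f-star (isStar m))

-- Comparison of the coefficients.

does-≟ : ∀ {n} (i j : Fin n) → does (i Fin.≟ j) ≡ (i == j)
does-≟ zero    zero    = refl
does-≟ zero    (suc j) = refl
does-≟ (suc i) zero    = refl
does-≟ (suc i) (suc j) = does-≟ i j

theorem5p1 : (n : ℕ) → 3 ≤ n → (G : SimpleGraph n) → UnicyclicOddGirth G →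
    (i : ℕ) → i ≤ n → φ i (S3' n) ≤ℤ φ i G
theorem5p1 n _ G (c , uw , odd) i i≤n = compare (OddUnicyclicGraph.oddUnicyclic G c uw odd)
  where
  module S = Relabelling ℕ._≟_ S3'adj S3'adj-sym S3'adj-irr (S3' n) toℕ (λ _ _ → refl) (λ _ _ → refl)
  module H = Relabelling Fin._≟_ (adj G) (symm G) (irrefl G) G id (λ _ _ → refl) does-≟
  module GS = Graph ℕ._≟_ S3'adj S3'adj-sym S3'adj-irr
  module GH = Graph Fin._≟_ (adj G) (symm G) (irrefl G)
  fS = GS.f (tabulate {n = n} toℕ)
  fG = GH.f (tabulate {n = n} id)

  compare : ∃[ m ] n ≡ 3 ℕ.+ m × GH.OddUnicyclic m (tabulate id) → φ i (S3' n) ≤ℤ φ i G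
  compare (m , n≡ , structure) = begin
    φ i (S3' n)                                    ≡⟨ S.φ-f i i≤n ⟩
    sign (n ℕ.∸ i) ℤ.* coeff fS (n ℕ.∸ i)          ≤⟨ ≼⇒≤ {fS} {fG} fS≼fG (n ℕ.∸ i) ⟩
    sign (n ℕ.∸ i) ℤ.* coeff fG (n ℕ.∸ i)          ≡⟨ H.φ-f i i≤n ⟨
    φ i G                                          ∎
    where
    open ℤ.≤-Reasoning
    fS≼fG : fS ≼ fG
    fS≼fG = ≼-trans {fS} {star m} {fG} (≼-reflexive {fS} {star m} (TriangleStar.f-S3' n≡)) (GH.f-bound structure)
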